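{- Let $G$ be a graph with $\mathrm{mad}(G)<\frac52$, girth $g(G)\geq 10$ and maximum degree $\Delta(G)=4$. Then $\chi^2_l(G)\leq 6$.
   Context: All graphs are finite and simple. The maximum average degree $\mathrm{mad}(G)$ is the maximum of $2|E(H)|/|V(H)|$ over all (nonempty) subgraphs $H$ of $G$. The girth $g(G)$ is the length of a shortest cycle of $G$. Given a list assignment $L=\{L(v)\}_{v\in V(G)}$, a $2$-distance $L$-coloring is a map $\phi$ with $\phi(v)\in L(v)$ for all $v$ such that any two distinct vertices at distance at most $2$ in $G$ receive different colors. $\chi^2_l(G)$ is the smallest $k$ such that $G$ has a $2$-distance $L$-coloring for every list assignment $L$ with $|L(v)|\geq k$ for all $v$. -}

module Defs where

open import Data.Nat using (ℕ; zero; suc; _+_; _*_; _≤_; _<_)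
open import Data.Fin using (Fin; zero; suc; inject₁; fromℕ; _<_)
open import Data.Fin.Subset using (Subset; _∈_; ∣_∣; Nonempty)
open import Data.Bool using (Bool; true; false; T)
open import Data.List using (List; length; filter; allFin; concatMap; map)
open import Data.List.Relation.Unary.Unique.Propositional using (Unique)
import Data.List.Membership.Propositional as LM
open import Data.Product using (Σ; ∃; ∃-syntax; _×_; _,_)
open import Data.Sum using (_⊎_)
open import Function.Definitions using (Injective)
open import Relation.Binary.PropositionalEquality using (_≡_)
open import Relation.Nullary using (¬_)
open import Relation.Nullary.Decidable using (does)
open import Data.Fin.Properties using () renaming (_<?_ to _<ᶠ?_)

record Graph (n : ℕ) : Set where
  field
    adj    : Fin n → Fin n → Bool
    sym    : ∀ u v → adj u v ≡ adj v u
    irrefl : ∀ v → adj v v ≡ false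
open Graph public

count : ∀ {n} → (Fin n → Bool) → ℕ
count {n} p = length (filter (λ v → T? (p v)) (allFin n))
  where
  open import Data.Bool.Properties using (T?)

degree : ∀ {n} → Graph n → Fin n → ℕ
degree G v = count (adj G v)

MaxDegreeEq : ∀ {n} → Graph n → ℕ → Set
MaxDegreeEq {n} G d = (∀ v → degree G v ≤ d) × ∃[ v ] (degree G v ≡ d)

edgeCount : ∀ {n} → (Fin n → Fin n → Bool) → ℕ
edgeCount {n} F = length (filter (λ uv → T? (edgeAt uv)) pairs)
  where
  open import Data.Bool.Properties using (T?)
  open import Data.Bool using (_∧_)
  pairs : List (Fin n × Fin n)
  pairs = concatMap (λ u → map (λ v → (u , v)) (allFin n)) (allFin n)
  edgeAt : Fin n × Fin n → Bool
  edgeAt (u , v) = does (u <ᶠ? v) ∧ F u v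

record Subgraph {n : ℕ} (G : Graph n) : Set where
  field
    verts    : Subset n
    edges    : Fin n → Fin n → Bool
    edgesSym : ∀ u v → edges u v ≡ edges v u
    edgesSub : ∀ u v → T (edges u v) → T (adj G u v)
    edgesIn  : ∀ u v → T (edges u v) → (u ∈ verts) × (v ∈ verts)
open Subgraph public

-- mad(G) < p/q  :  for every nonempty subgraph H, 2|E(H)|/|V(H)| < p/q,
-- i.e. q·2|E(H)| < p·|V(H)|.
MadLess : ∀ {n} → Graph n → ℕ → ℕ → Set
MadLess G p q = ∀ (H : Subgraph G) → Nonempty (verts H) →
  q * (2 * edgeCount (edges H)) Data.Nat.< p * ∣ verts H ∣

IsCycle : ∀ {n} → Graph n → (m : ℕ) → (Fin (suc m) → Fin n) → Set
IsCycle G m f =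
  (2 ≤ m) × Injective _≡_ _≡_ f ×
  (∀ (i : Fin m) → T (adj G (f (inject₁ i)) (f (suc i)))) ×
  T (adj G (f (fromℕ m)) (f zero))

-- girth(G) ≥ g : G has no cycle of length < g (acyclic graphs have
-- infinite girth).
GirthAtLeast : ∀ {n} → Graph n → ℕ → Set
GirthAtLeast G g = ∀ (m : ℕ) (f : Fin (suc m) → Fin _) →
  suc m Data.Nat.< g → ¬ IsCycle G m f

-- distance at most 2 between distinct vertices
Dist≤2 : ∀ {n} → Graph n → Fin n → Fin n → Set
Dist≤2 G u v = T (adj G u v) ⊎ ∃[ w ] (T (adj G u w) × T (adj G w v))

-- A list assignment (colours are natural numbers); lists are duplicate-free.
ListAssignment : ℕ → Set
ListAssignment n = Fin n → List ℕ

Is2DistLColoring : ∀ {n} → Graph n → ListAssignment n → (Fin n → ℕ) → Set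
Is2DistLColoring G L φ =
  (∀ v → φ v LM.∈ L v) ×
  (∀ u v → ¬ (u ≡ v) → Dist≤2 G u v → ¬ (φ u ≡ φ v))

ListChi2AtMost : ∀ {n} → Graph n → ℕ → Set
ListChi2AtMost {n} G k = ∀ (L : ListAssignment n) →
  (∀ v → Unique (L v)) → (∀ v → k ≤ length (L v)) →
  ∃[ φ ] Is2DistLColoring G L φ

{-# OPTIONS --safe #-}

-- A minimal counterexample has no reducible configuration.  In each configuration a few vertices
-- are uncoloured; counting the coloured vertices within distance two bounds from below the lists
-- they are left with, and girth at least 10 guarantees that no two of them conflict except along
-- the configuration itself.  Write k-path for a path with k inner vertices of degree 2 between
-- vertices of degree at least 3.  Excluded are leaves; 2-paths that do not join two 4-vertices;
-- 4-vertices on two 2-paths whose other two neighbours are nearly as constrained (hub-reducible);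
-- and a 3-vertex on three 1-paths, one of them leading to a 3-vertex, another to a vertex y with
-- little freedom (triple-…-reducible).
--
-- Discharging with initial charge 24 d(v) − 60 then shows that the average degree is at least 5/2:
-- a 4-vertex gives 12 along each 2-path and 6 along each 1-path, a 3-vertex gives 6 along each
-- 1-path, and the remaining surplus feeds the 3-vertices on three 1-paths (short of 6) and the
-- 3-vertices on two 1-paths through which charge is passed on to them.
module Submission where

open import Defs
open import Data.Nat using (ℕ)
open import Data.Nat as ℕ using (zero; suc; _+_; _*_; _≤_; _<_; _≤?_; z≤n; s≤s)
import Data.Nat.Properties as ℕₚ
open import Data.Nat.ListAction using (sum)
open import Data.Nat.ListAction.Properties using (sum-↭; sum-++)
open import Data.Nat.Tactic.RingSolver using (solve-∀)
open import Data.Bool using (Bool; true; false; T; if_then_else_; _∧_; not)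
open import Data.Bool.Properties using (T?; T-∧)
import Data.Bool.Properties as Boolₚ
open import Data.Fin using (Fin; zero; suc; inject₁; fromℕ)
open import Data.Fin.Properties using (_≟_; all?; any?; <-cmp) renaming (_<?_ to _<ᶠ?_)
open import Data.Fin.Subset using (∣_∣)
import Data.Vec as Vec
import Data.Vec.Properties as Vecₚ
open import Data.List
  using (List; []; _∷_; _++_; length; filter; allFin; map; take; lookup; concatMap; tabulate)
open import Data.List.Properties
  using (filter-all; filter-accept; filter-reject; length-take; length-map; map-++; map-∘; map-tabulate)
open import Data.List.Membership.Propositional using (_∈_; _∉_)
import Data.List.Membership.Propositional as Membership
open import Data.List.Membership.Propositional.Properties
  using (∈-filter⁺; ∈-filter⁻; ∈-∃++; ∈-allFin; ∈-map⁺; ∈-lookup)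
open import Data.List.Relation.Unary.Any using (Any; here; there)
import Data.List.Relation.Unary.Any as Any
open import Data.List.Relation.Unary.All as All using (All; []; _∷_)
import Data.List.Relation.Unary.All.Properties as Allₚ
open import Data.List.Relation.Unary.AllPairs using ([]; _∷_; AllPairs)
open import Data.List.Relation.Unary.Unique.Propositional using (Unique)
import Data.List.Relation.Unary.Unique.Propositional.Properties as Uniqueₚ
open import Data.List.Relation.Binary.Permutation.Propositional
  using (_↭_; refl; prep; swap; ↭-sym; ↭-trans; ↭-reflexive; ↭⇒↭ₛ)
open import Data.List.Relation.Binary.Permutation.Propositional.Properties
  using (∈-resp-↭; Any-resp-↭; All-resp-↭; ↭-length; shift; map⁺; filter-↭)
import Data.List.Relation.Binary.Permutation.Setoid.Properties as Permₛ
open import Data.Product using (∃; ∃₂; _×_; _,_; proj₁; proj₂)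
open import Data.Sum using (_⊎_; inj₁; inj₂)
open import Data.Empty using (⊥; ⊥-elim)
open import Data.Unit using (⊤; tt)
open import Function using (_∘_; id; case_of_; Equivalence)
open import Relation.Binary.Definitions using (tri<; tri≈; tri>)
open import Relation.Binary.PropositionalEquality
  using (_≡_; _≢_; _≗_; refl; cong; cong₂; subst; subst₂; trans; ≢-sym; setoid)
  renaming (sym to ≡-sym)
open import Relation.Nullary using (¬_; Dec; yes; no; does)
open import Relation.Nullary.Decidable
  using (¬?; _×-dec_; _⊎-dec_; _→-dec_; map′; decidable-stable; dec-true; dec-false)

-- Removing forbidden colours from a list.

infixl 6 _∖_

_∖_ : List ℕ → List ℕ → List ℕ
xs ∖ []       = xs
xs ∖ (y ∷ ys) = filter (λ x → ¬? (x ℕ.≟ y)) xs ∖ ys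

∖-unique : ∀ {xs} ys → Unique xs → Unique (xs ∖ ys)
∖-unique []       u = u
∖-unique (y ∷ ys) u = ∖-unique ys (Uniqueₚ.filter⁺ _ u)

∈-∖⁻ : ∀ {c xs} ys → c ∈ xs ∖ ys → c ∈ xs × c ∉ ys
∈-∖⁻ []       c∈ = c∈ , λ ()
∈-∖⁻ {xs = xs} (y ∷ ys) c∈ with ∈-∖⁻ ys c∈
... | c∈f , c∉ys with ∈-filter⁻ (λ x → ¬? (x ℕ.≟ y)) {xs = xs} c∈f
... | c∈xs , c≢y = c∈xs , λ { (here c≡y) → c≢y c≡y ; (there c∈ys) → c∉ys c∈ys }

-- A duplicate-free list contains `y` at most once, so filtering it out costs at most one entry.
length-filter-≢ : ∀ {xs} y → Unique xs → length xs ≤ suc (length (filter (λ x → ¬? (x ℕ.≟ y)) xs))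
length-filter-≢ y [] = z≤n
length-filter-≢ {x ∷ xs} y (x∉ ∷ u) with x ℕ.≟ y
... | no  x≢y rewrite filter-accept (λ z → ¬? (z ℕ.≟ y)) {xs = xs} x≢y = s≤s (length-filter-≢ y u)
... | yes refl rewrite filter-reject (λ z → ¬? (z ℕ.≟ y)) {xs = xs} (λ y≢y → y≢y refl)
                     | filter-all (λ z → ¬? (z ℕ.≟ y)) (All.map ≢-sym x∉) = ℕₚ.≤-refl

length-∖ : ∀ {xs} ys → Unique xs → length xs ≤ length ys + length (xs ∖ ys)
length-∖ []       u = ℕₚ.≤-refl
length-∖ {xs} (y ∷ ys) u = begin
  length xs                                     ≤⟨ length-filter-≢ y u ⟩
  suc (length zs)                               ≤⟨ s≤s (length-∖ ys (Uniqueₚ.filter⁺ _ u)) ⟩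
  suc (length ys + length (zs ∖ ys))            ∎
  where
  open ℕₚ.≤-Reasoning
  zs = filter (λ x → ¬? (x ℕ.≟ y)) xs

pick : ∀ {xs} ys → Unique xs → length ys < length xs → ∃ λ c → c ∈ xs × c ∉ ys
pick {xs} ys u ys<xs with xs ∖ ys in eq | length-∖ ys u
... | []    | le = ⊥-elim (ℕₚ.<⇒≱ ys<xs (subst (length xs ≤_) (ℕₚ.+-identityʳ _) le))
... | c ∷ _ | _  = c , ∈-∖⁻ ys (subst (c ∈_) (≡-sym eq) (here refl))

-- Neighbourhoods and walks.

module _ {n : ℕ} (G : Graph n) where

  infix 4 _~_ _⇉_

  _~_ : Fin n → Fin n → Set
  u ~ v = T (adj G u v)

  ~-sym : ∀ {u v} → u ~ v → v ~ u
  ~-sym {u} {v} = subst T (Graph.sym G u v)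

  ~⇒≢ : ∀ {u v} → u ~ v → u ≢ v
  ~⇒≢ {u} u~u refl = subst T (irrefl G u) u~u

  N : Fin n → List (Fin n)
  N v = filter (λ u → T? (adj G v u)) (allFin n)

  d : Fin n → ℕ
  d = degree G

  -- Equality up to permutation: a configuration can name the neighbours of `v` in whatever order
  -- suits it, and the length of the list is the degree.
  _⇉_ : Fin n → List (Fin n) → Set
  v ⇉ us = N v ↭ us

  ∈N⁺ : ∀ {u v} → v ~ u → u ∈ N v
  ∈N⁺ {u} {v} v~u = ∈-filter⁺ (λ w → T? (adj G v w)) (∈-allFin u) v~u

  ∈N⁻ : ∀ {u v} → u ∈ N v → v ~ u
  ∈N⁻ {u} {v} u∈ = proj₂ (∈-filter⁻ (λ w → T? (adj G v w)) {xs = allFin n} u∈)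

  ⇉-adj : ∀ {v us u} → v ⇉ us → u ∈ us → v ~ u
  ⇉-adj σ u∈ = ∈N⁻ (∈-resp-↭ (↭-sym σ) u∈)

  ⇉-complete : ∀ {v us u} → v ⇉ us → v ~ u → u ∈ us
  ⇉-complete σ v~u = ∈-resp-↭ σ (∈N⁺ v~u)

  ⇉-unique : ∀ {v us} → v ⇉ us → Unique us
  ⇉-unique σ = Permₛ.Unique-resp-↭ (setoid (Fin n)) (↭⇒↭ₛ σ) (Uniqueₚ.filter⁺ _ (Uniqueₚ.allFin⁺ n))

  ⇉-degree : ∀ {v us} → v ⇉ us → d v ≡ length us
  ⇉-degree σ = ↭-length σ

  ⇉-front : ∀ {u v} → v ~ u → ∃ λ us → v ⇉ u ∷ us
  ⇉-front {u} {v} v~u with ∈-∃++ (∈N⁺ v~u)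
  ... | as , bs , eq = as ++ bs , ↭-trans (↭-reflexive eq) (shift u as bs)

  -- Non-backtracking walks: consecutive vertices are adjacent and vertices two steps apart differ.
  Walk : List (Fin n) → Set
  Walk []               = ⊤
  Walk (x ∷ [])         = ⊤
  Walk (x ∷ y ∷ [])     = x ~ y
  Walk (x ∷ y ∷ z ∷ xs) = x ~ y × x ≢ z × Walk (y ∷ z ∷ xs)

  walk-tail : ∀ {x} xs → Walk (x ∷ xs) → Walk xs
  walk-tail []           _           = tt
  walk-tail (y ∷ [])     _           = tt
  walk-tail (y ∷ z ∷ xs) (_ , _ , w) = w

  walk-head : ∀ {x y} xs → Walk (x ∷ y ∷ xs) → x ~ y
  walk-head []       e       = e
  walk-head (z ∷ xs) (e , _) = e

  walk-steps : ∀ x ys zs → Walk (x ∷ ys ++ zs) →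
    ∀ (i : Fin (length ys)) → lookup (x ∷ ys) (inject₁ i) ~ lookup ys i
  walk-steps x (y ∷ ys) zs w zero    = walk-head (ys ++ zs) w
  walk-steps x (y ∷ ys) zs w (suc i) = walk-steps y ys zs (walk-tail (y ∷ ys ++ zs) w) i

  walk-last : ∀ x ys z zs → Walk (x ∷ ys ++ z ∷ zs) → lookup (x ∷ ys) (fromℕ (length ys)) ~ z
  walk-last x []       z zs w = walk-head zs w
  walk-last x (y ∷ ys) z zs w = walk-last y ys z zs (walk-tail (y ∷ ys ++ z ∷ zs) w)

  lookup-injective : ∀ {xs : List (Fin n)} → Unique xs → ∀ {i j} → lookup xs i ≡ lookup xs j → i ≡ j
  lookup-injective (x∉ ∷ u) {zero}  {zero}  _  = refl
  lookup-injective (x∉ ∷ u) {zero}  {suc j} eq = ⊥-elim (All.lookup x∉ (∈-lookup j) eq)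
  lookup-injective (x∉ ∷ u) {suc i} {zero}  eq = ⊥-elim (All.lookup x∉ (∈-lookup i) (≡-sym eq))
  lookup-injective (x∉ ∷ u) {suc i} {suc j} eq = cong suc (lookup-injective u eq)

  -- Short non-backtracking walks are paths.

  module Girth (girth : GirthAtLeast G 10) where

    -- The walk from `x` back to its next occurrence would close a cycle of length
    -- `suc (length ys)`, at most 9. Lengths 1 and 2, which are not cycles, are excluded by
    -- irreflexivity and by non-backtracking.
    no-return : ∀ x ys zs → Walk (x ∷ ys ++ x ∷ zs) → Unique (ys ++ x ∷ zs) → length ys < 9 → ⊥
    no-return x []            zs w u lt = ~⇒≢ (walk-head zs w) refl
    no-return x (y ∷ [])      zs w u lt = proj₁ (proj₂ w) refl
    no-return x ys@(_ ∷ _ ∷ _) zs w u lt =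
      girth (length ys) (lookup (x ∷ ys)) (s≤s lt)
        ( s≤s (s≤s z≤n) , lookup-injective (x∉ ∷ uys)
        , walk-steps x ys (x ∷ zs) w , walk-last x ys x zs w)
      where
      split : ∀ (as : List (Fin n)) → Unique (as ++ x ∷ zs) → All (x ≢_) as × Unique as
      split []       _         = [] , []
      split (a ∷ as) (a∉ ∷ u′) with split as u′
      ... | x∉as , uas = ≢-sym (All.lookup a∉ (∈-++-mid as)) ∷ x∉as , Allₚ.++⁻ˡ as a∉ ∷ uas
        where
        ∈-++-mid : ∀ (as : List (Fin n)) → x ∈ as ++ x ∷ zs
        ∈-++-mid []       = here refl
        ∈-++-mid (_ ∷ as) = there (∈-++-mid as)
      x∉  = proj₁ (split ys u)
      uys = proj₂ (split ys u)

    -- By induction the tail has no repetition, so only a return to the head remains. With at most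
    -- 10 vertices on the walk, fewer than 9 lie strictly between the two occurrences.
    walk-unique : ∀ xs → Walk xs → length xs ≤ 10 → Unique xs
    walk-unique []       w le = []
    walk-unique (x ∷ xs) w le = All.tabulate x∉ ∷ u
      where
      u : Unique xs
      u = walk-unique xs (walk-tail xs w) (ℕₚ.≤-trans (ℕₚ.n≤1+n _) le)
      x∉ : ∀ {z} → z ∈ xs → x ≢ z
      x∉ z∈ refl with ∈-∃++ z∈
      ... | ys , zs , refl = no-return x ys zs w u (short ys le)
        where
        short : ∀ {m} (as : List (Fin n)) → suc (length (as ++ x ∷ zs)) ≤ suc m → length as < m
        short {suc m} []       _        = s≤s z≤n
        short {suc m} (a ∷ as) (s≤s le) = s≤s (short as le)
        short {zero}  []       (s≤s ())
        short {zero}  (a ∷ as) (s≤s ())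

    -- A connection of length one or two from `z` to `x₀`, prepended to the walk, gives a
    -- non-backtracking walk that meets `z` twice. The bound 5 keeps this longer walk within 10
    -- vertices.
    walk-far : ∀ x₀ x₁ x₂ xs {z} → Walk (x₀ ∷ x₁ ∷ x₂ ∷ xs) → length xs ≤ 5 → z ∈ xs →
      ¬ Dist≤2 G x₀ z
    walk-far x₀ x₁ x₂ xs {z} w le z∈ D = go D
      where
      u : Unique (x₀ ∷ x₁ ∷ x₂ ∷ xs)
      u = walk-unique _ w (ℕₚ.≤-trans (s≤s (s≤s (s≤s le))) (ℕₚ.m≤m+n 8 2))
      z≢x₁ : z ≢ x₁
      z≢x₁ = case u of λ { (_ ∷ (_ ∷ a) ∷ _) → ≢-sym (All.lookup a z∈) }
      z≢x₂ : z ≢ x₂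
      z≢x₂ = case u of λ { (_ ∷ _ ∷ a ∷ _) → ≢-sym (All.lookup a z∈) }
      z≢x₀ : z ≢ x₀
      z≢x₀ = case u of λ { ((_ ∷ _ ∷ a) ∷ _) → ≢-sym (All.lookup a z∈) }
      repeat : ∀ ys → Unique (z ∷ ys ++ xs) → ⊥
      repeat ys (a ∷ _) = All.lookup (Allₚ.++⁻ʳ ys a) z∈ refl
      go : Dist≤2 G x₀ z → ⊥
      go (inj₁ e) = repeat (x₀ ∷ x₁ ∷ x₂ ∷ [])
        (walk-unique _ (~-sym e , z≢x₁ , w) (ℕₚ.≤-trans (s≤s (s≤s (s≤s (s≤s le)))) (ℕₚ.m≤m+n 9 1)))
      go (inj₂ (y , e , f)) with y ≟ x₁
      -- Prepending `z`, `x₁` to the whole walk would backtrack at `x₀`; the edge from `z` to `x₁`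
      -- is prepended to the walk from `x₁` on instead.
      ... | yes refl = repeat (x₁ ∷ x₂ ∷ [])
        (walk-unique _ (~-sym f , z≢x₂ , proj₂ (proj₂ w))
          (ℕₚ.≤-trans (s≤s (s≤s (s≤s le))) (ℕₚ.m≤m+n 8 2)))
      ... | no y≢x₁ = repeat (y ∷ x₀ ∷ x₁ ∷ x₂ ∷ [])
        (walk-unique _ (~-sym f , z≢x₀ , ~-sym e , y≢x₁ , w) (s≤s (s≤s (s≤s (s≤s (s≤s le))))))

-- Deleting the edges at a vertex.

delete : ∀ {n} → Graph n → Fin n → Graph n
delete G r = record
  -- The vertex `r` stays as an isolated vertex, so the vertex set and the list assignment do not
  -- change under deletion.
  { adj    = λ u v → adj G u v ∧ (not (does (u ≟ r)) ∧ not (does (v ≟ r)))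
  ; sym    = λ u v → cong₂ _∧_ (Graph.sym G u v) (Boolₚ.∧-comm (not (does (u ≟ r))) _)
  ; irrefl = λ v → cong (_∧ _) (irrefl G v)
  }

module _ {n} {G : Graph n} {r : Fin n} where

  delete-~⁺ : ∀ {u v} → _~_ G u v → u ≢ r → v ≢ r → _~_ (delete G r) u v
  delete-~⁺ {u} {v} e u≢r v≢r with u ≟ r | v ≟ r
  ... | yes eq | _      = ⊥-elim (u≢r eq)
  ... | no _   | yes eq = ⊥-elim (v≢r eq)
  ... | no _   | no _   = Equivalence.from T-∧ (e , tt)

  delete-~⁻ : ∀ {u v} → _~_ (delete G r) u v → _~_ G u v
  delete-~⁻ e = proj₁ (Equivalence.to T-∧ e)

  delete-isolated : ∀ {v} → ¬ _~_ (delete G r) r v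
  delete-isolated {v} e with adj G r v | r ≟ r
  ... | false | _       = e
  ... | true  | yes _   = e
  ... | true  | no r≢r  = r≢r refl

-- Exhaustive search over the colourings from given lists.

search : ∀ {n} (L : Fin n → List ℕ) {P : (Fin n → ℕ) → Set} →
  (∀ φ → Dec (P φ)) → (∀ {φ ψ} → φ ≗ ψ → P φ → P ψ) →
  Dec (∃ λ φ → (∀ v → φ v ∈ L v) × P φ)
search {zero} L P? resp = map′ (λ p → _ , (λ ()) , p) (λ { (_ , _ , p) → resp (λ ()) p }) (P? (λ ()))
search {suc n} L {P} P? resp = map′ to from (Any.any? step (L zero))
  where
  cons : ℕ → (Fin n → ℕ) → Fin (suc n) → ℕ
  cons c φ zero    = c
  cons c φ (suc v) = φ v
  Tail : ℕ → Set
  Tail c = ∃ λ φ → (∀ v → φ v ∈ L (suc v)) × P (cons c φ)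
  step : ∀ c → Dec (Tail c)
  step c = search (L ∘ suc) (P? ∘ cons c) (λ φ≗ψ → resp λ { zero → refl ; (suc v) → φ≗ψ v })
  to : Any Tail (L zero) → ∃ λ φ → (∀ v → φ v ∈ L v) × P φ
  to t with Membership.find t
  ... | c , c∈ , φ , φ∈ , p = cons c φ , (λ { zero → c∈ ; (suc v) → φ∈ v }) , p
  from : (∃ λ φ → (∀ v → φ v ∈ L v) × P φ) → Any Tail (L zero)
  -- Splitting `φ` into head and tail and reassembling it with `cons` gives back `φ` only pointwise;
  -- `resp` transports `P` along this.
  from (φ , φ∈ , p) = Membership.lose (φ∈ zero)
    (φ ∘ suc , φ∈ ∘ suc , resp (λ { zero → refl ; (suc _) → refl }) p)

-- Partial colourings and their extension.

pattern at0 = here refl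
pattern at1 = there at0
pattern at2 = there at1
pattern at3 = there at2
pattern at4 = there at3
pattern at5 = there at4
pattern at6 = there at5

module Colouring {n} (G : Graph n) (L : ListAssignment n) where

  Colourable : Set
  Colourable = ∃ λ φ → Is2DistLColoring G L φ

  -- Decidability makes the argument by minimal counterexample constructive: it suffices to refute
  -- `¬ Colourable`.
  colourable? : Dec Colourable
  colourable? = search L proper? λ φ≗ψ p u v u≢v D eq →
    p u v u≢v D (trans (φ≗ψ u) (trans eq (≡-sym (φ≗ψ v))))
    where
    dist? : ∀ u v → Dec (Dist≤2 G u v)
    dist? u v = T? _ ⊎-dec any? (λ w → T? _ ×-dec T? _)
    proper? : ∀ φ → Dec (∀ u v → ¬ (u ≡ v) → Dist≤2 G u v → ¬ (φ u ≡ φ v))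
    proper? φ = all? λ u → all? λ v → ¬? (u ≟ v) →-dec (dist? u v →-dec ¬? (φ u ℕ.≟ φ v))

  Dist-sym : ∀ {u v} → Dist≤2 G u v → Dist≤2 G v u
  Dist-sym (inj₁ e)           = inj₁ (~-sym G e)
  Dist-sym (inj₂ (w , e , f)) = inj₂ (w , ~-sym G f , ~-sym G e)

  -- φ is a 2-distance L-colouring of the vertices outside U; distances are those of G.
  Partial : (Fin n → ℕ) → List (Fin n) → Set
  Partial φ U = (∀ v → v ∉ U → φ v ∈ L v) ×
    (∀ u v → u ∉ U → v ∉ U → u ≢ v → Dist≤2 G u v → φ u ≢ φ v)

  Allowed : (Fin n → ℕ) → List (Fin n) → Fin n → ℕ → Set
  Allowed φ U u c = c ∈ L u × (∀ w → w ∉ U → w ≢ u → Dist≤2 G u w → c ≢ φ w)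

  recolour : Fin n → ℕ → (Fin n → ℕ) → Fin n → ℕ
  recolour u c φ w = if does (w ≟ u) then c else φ w

  recolour-partial : ∀ {φ u U c} → Partial φ (u ∷ U) → Allowed φ (u ∷ U) u c →
    Partial (recolour u c φ) U
  recolour-partial {φ} {u} {U} {c} (φ∈ , proper) (c∈ , ok) = φ∈′ , proper′
    where
    ∉∷ : ∀ {w} → w ∉ U → w ≢ u → w ∉ u ∷ U
    ∉∷ w∉ w≢u (here eq)  = w≢u eq
    ∉∷ w∉ w≢u (there w∈) = w∉ w∈
    φ∈′ : ∀ v → v ∉ U → recolour u c φ v ∈ L v
    φ∈′ v v∉ with v ≟ u
    ... | yes refl = c∈
    ... | no v≢u   = φ∈ v (∉∷ v∉ v≢u)
    proper′ : ∀ v w → v ∉ U → w ∉ U → v ≢ w → Dist≤2 G v w → recolour u c φ v ≢ recolour u c φ w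
    proper′ v w v∉ w∉ v≢w D with v ≟ u | w ≟ u
    ... | yes refl | yes refl = ⊥-elim (v≢w refl)
    ... | yes refl | no w≢u   = ok w (∉∷ w∉ w≢u) w≢u D
    ... | no v≢u   | yes refl = ≢-sym (ok v (∉∷ v∉ v≢u) v≢u (Dist-sym D))
    ... | no v≢u   | no w≢u   = proper v w (∉∷ v∉ v≢u) (∉∷ w∉ w≢u) v≢w D

  Compatible : Fin n × ℕ → Fin n × ℕ → Set
  Compatible (u , c) (v , e) = Dist≤2 G u v → c ≢ e

  -- The vertices are coloured one after another. Once `u` has its colour, the `Compatible`
  -- condition between `u` and a later vertex supplies what `Allowed` newly demands of that vertex.
  extend : ∀ cs {φ} → Partial φ (map proj₁ cs) →
    All (λ (u , c) → Allowed φ (map proj₁ cs) u c) cs → AllPairs Compatible cs → Colourable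
  extend [] {φ} (φ∈ , proper) _ _ =
    φ , (λ v → φ∈ v (λ ())) , λ u v → proper u v (λ ()) (λ ())
  extend ((u , c) ∷ cs) {φ} part (ok ∷ oks) (cp ∷ cps) =
    extend cs (recolour-partial part ok) (All.zipWith weaken (oks , cp)) cps
    where
    weaken : ∀ {(v , e) : Fin n × ℕ} →
      Allowed φ (u ∷ map proj₁ cs) v e × Compatible (u , c) (v , e) →
      Allowed (recolour u c φ) (map proj₁ cs) v e
    weaken {v , e} ((e∈ , ok′) , c≢e) = e∈ , λ w w∉ w≢v D → new w w∉ w≢v D
      where
      new : ∀ w → w ∉ map proj₁ cs → w ≢ v → Dist≤2 G v w → e ≢ recolour u c φ w
      new w w∉ w≢v D with w ≟ u
      ... | yes refl = ≢-sym (c≢e (Dist-sym D))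
      ... | no w≢u   = ok′ w (λ { (here eq) → w≢u eq ; (there w∈) → w∉ w∈ }) w≢v D

  -- Deletion destroys only connections that use an edge at `r`. As `r` is uncoloured and has at
  -- most one neighbour `s` outside `U`, no two distinct vertices outside `U` are joined by such a
  -- connection.
  delete-partial : ∀ {φ r U us} s → r ∈ U → _⇉_ G r us → All (λ a → a ≡ s ⊎ a ∈ U) us →
    Is2DistLColoring (delete G r) L φ → Partial φ U
  delete-partial {φ} {r} {U} {us} s r∈ σ outer (φ∈ , proper) =
    (λ v _ → φ∈ v) , λ u v u∉ v∉ u≢v D → proper u v u≢v (dist u∉ v∉ u≢v D)
    where
    ≢r : ∀ {w} → w ∉ U → w ≢ r
    ≢r w∉ refl = w∉ r∈
    only : ∀ {w} → w ∉ U → _~_ G r w → w ≡ s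
    only w∉ e with All.lookup outer (⇉-complete G σ e)
    ... | inj₁ eq = eq
    ... | inj₂ w∈ = ⊥-elim (w∉ w∈)
    dist : ∀ {u v} → u ∉ U → v ∉ U → u ≢ v → Dist≤2 G u v → Dist≤2 (delete G r) u v
    dist u∉ v∉ u≢v (inj₁ e) = inj₁ (delete-~⁺ {G = G} e (≢r u∉) (≢r v∉))
    dist u∉ v∉ u≢v (inj₂ (w , e , f)) with w ≟ r
    ... | yes refl = ⊥-elim (u≢v (trans (only u∉ (~-sym G e)) (≡-sym (only v∉ f))))
    ... | no w≢r   = inj₂ (w , delete-~⁺ {G = G} e (≢r u∉) w≢r , delete-~⁺ {G = G} f w≢r (≢r v∉))

  -- The size is exact rather than a lower bound, so that a larger palette is sure to contain a
  -- colour missing from a smaller one.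
  record Palette (φ : Fin n → ℕ) (U : List (Fin n)) (u : Fin n) (k : ℕ) : Set where
    field
      colours : List ℕ
      unique  : Unique colours
      size    : length colours ≡ k
      allowed : ∀ {c} → c ∈ colours → Allowed φ U u c

  choose : ∀ {φ U u k} (P : Palette φ U u k) cs → length cs < k →
    ∃ λ c → c ∈ Palette.colours P × c ∉ cs
  choose P cs lt = pick cs (Palette.unique P) (subst (length cs <_) (≡-sym (Palette.size P)) lt)

  module _ (U cs : List (Fin n)) (u : Fin n) where

    Seen : Fin n → Set
    Seen w = w ≡ u ⊎ w ∈ U ⊎ w ∈ cs

    -- If every neighbour `t` of `u` is a branch, then `cs` accounts for all coloured vertices
    -- within distance two of `u`.
    Branch : Fin n → Set
    Branch t = Seen t × ∃ λ rs → _⇉_ G t rs × All Seen rs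

  pattern self  = inj₁ refl
  pattern unc m = inj₂ (inj₁ m)
  pattern out m = inj₂ (inj₂ m)

  outs : ∀ {U u} {zs cs : List (Fin n)} → (∀ {w} → w ∈ zs → w ∈ cs) → All (Seen U cs u) zs
  outs sub = All.tabulate (λ m → out (sub m))

  module Lists (unique : ∀ v → Unique (L v)) (six : ∀ v → 6 ≤ length (L v)) where

    -- Only the colours on `cs` are forbidden at `u`, and they remove at most `length cs` of at
    -- least six; the rest is truncated to `k` colours.
    palette : ∀ {φ U u ts k} cs → _⇉_ G u ts → All (Branch U cs u) ts → length cs + k ≤ 6 →
      Palette φ U u k
    palette {φ} {U} {u} {ts} {k} cs σ branches le = record
      { colours = take k xs
      ; unique  = Uniqueₚ.take⁺ k (∖-unique (map φ cs) (unique u))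
      ; size    = trans (length-take k xs) (ℕₚ.m≤n⇒m⊓n≡m k≤)
      ; allowed = λ c∈ → let c∈L , c∉ = ∈-∖⁻ (map φ cs) (take-⊆ c∈) in
          c∈L , λ w w∉ w≢u D eq → c∉ (subst (_∈ map φ cs) (≡-sym eq) (∈-map⁺ φ (cover w w∉ w≢u D)))
      }
      where
      xs : List ℕ
      xs = L u ∖ map φ cs
      take-⊆ : ∀ {c} → c ∈ take k xs → c ∈ xs
      take-⊆ = All.lookup (Allₚ.take⁺ k (All.tabulate id))
      k≤ : k ≤ length xs
      k≤ = ℕₚ.+-cancelˡ-≤ (length cs) _ _ (ℕₚ.≤-trans le (ℕₚ.≤-trans (six u)
        (subst (λ m → length (L u) ≤ m + length xs) (length-map φ cs) (length-∖ (map φ cs) (unique u)))))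
      seen : ∀ {w} → w ∉ U → w ≢ u → Seen U cs u w → w ∈ cs
      seen w∉ w≢u (inj₁ eq) = ⊥-elim (w≢u eq)
      seen w∉ w≢u (unc w∈)  = ⊥-elim (w∉ w∈)
      seen w∉ w≢u (out w∈)  = w∈
      cover : ∀ w → w ∉ U → w ≢ u → Dist≤2 G u w → w ∈ cs
      cover w w∉ w≢u (inj₁ e) = seen w∉ w≢u (proj₁ (All.lookup branches (⇉-complete G σ e)))
      cover w w∉ w≢u (inj₂ (t , e , f)) with All.lookup branches (⇉-complete G σ e)
      ... | _ , rs , ρ , rest = seen w∉ w≢u (All.lookup rest (⇉-complete G ρ f))

-- Filtered lists.

length-filter-∷ : ∀ {A : Set} {P : A → Set} (P? : ∀ x → Dec (P x)) x xs →
  length (filter P? (x ∷ xs)) ≤ suc (length (filter P? xs))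
length-filter-∷ P? x xs with does (P? x)
... | true  = ℕₚ.≤-refl
... | false = ℕₚ.n≤1+n _

split-↭ : ∀ {A : Set} {P : A → Set} (P? : ∀ x → Dec (P x)) xs →
  xs ↭ filter P? xs ++ filter (¬? ∘ P?) xs
split-↭ P? []       = refl
split-↭ P? (x ∷ xs) with P? x
... | yes _ = prep x (split-↭ P? xs)
... | no  _ = ↭-trans (prep x (split-↭ P? xs)) (↭-sym (shift x (filter P? xs) _))

filter-pair : ∀ {A : Set} {P : A → Set} (P? : ∀ x → Dec (P x)) {x a b} → ¬ P x →
  length (filter P? (x ∷ a ∷ b ∷ [])) ≡ 2 → P a × P b
filter-pair P? {x} {a} {b} ¬px len with P? a | P? b
... | yes pa | yes pb = pa , pb
... | no ¬pa | _      = ⊥-elim (ℕₚ.<⇒≱ {1} {2} ℕₚ.≤-refl (subst (_≤ 1) len (ℕₚ.≤-trans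
  (ℕₚ.≤-reflexive (cong length (trans (filter-reject P? ¬px) (filter-reject P? ¬pa))))
  (length-filter-∷ P? b []))))
... | yes _  | no ¬pb = ⊥-elim (ℕₚ.<⇒≱ {1} {2} ℕₚ.≤-refl (subst (_≤ 1) len (ℕₚ.≤-trans
  (ℕₚ.≤-reflexive (cong length (filter-reject P? ¬px)))
  (ℕₚ.≤-trans (length-filter-∷ P? a (b ∷ [])) (s≤s (ℕₚ.≤-reflexive (cong length (filter-reject P? ¬pb))))))))

-- The discharging rules.

module Local {n} (G : Graph n) where

  private
    _⟶_ : Fin n → List (Fin n) → Set
    _⟶_ = _⇉_ G
    infix 4 _⟶_

  other : Fin n → List (Fin n) → Fin n
  other u []       = u
  other u (x ∷ xs) = if does (x ≟ u) then other u xs else x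

  -- The end opposite to u of the path of length two through its neighbour t, when t has degree 2.
  opp : Fin n → Fin n → Fin n
  opp u t = other u (N G t)

  opp-≡ : ∀ {u t w} → t ⟶ u ∷ w ∷ [] → opp u t ≡ w
  opp-≡ {u} {t} {w} σ = go (N G t) (∈N⁺ G (⇉-adj G σ at1)) only
    where
    u≢w : u ≢ w
    u≢w with ⇉-unique G σ
    ... | (u≢w ∷ _) ∷ _ = u≢w
    only : ∀ {z} → z ∈ N G t → z ≢ u → z ≡ w
    only z∈ z≢u with ∈-resp-↭ σ z∈
    ... | at0 = ⊥-elim (z≢u refl)
    ... | at1 = refl
    go : ∀ xs → w ∈ xs → (∀ {z} → z ∈ xs → z ≢ u → z ≡ w) → other u xs ≡ w
    go (x ∷ xs) w∈ only with x ≟ u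
    go (x ∷ xs) w∈ only | no x≢u = only at0 x≢u
    go (x ∷ xs) at0 only | yes x≡u = ⊥-elim (u≢w (≡-sym x≡u))
    go (x ∷ xs) (there w∈) only | yes _ = go xs w∈ (only ∘ there)

  TwoPath : Fin n → Fin n → Set
  TwoPath x t = d G t ≡ 2 × d G (opp x t) ≡ 2

  twoPath? : ∀ x t → Dec (TwoPath x t)
  twoPath? x t = (d G t ℕ.≟ 2) ×-dec (d G (opp x t) ℕ.≟ 2)

  Thin : Fin n → Set
  Thin x = All (λ t → d G t ≡ 2) (N G x)

  thin? : ∀ x → Dec (Thin x)
  thin? x = All.all? (λ t → d G t ℕ.≟ 2) (N G x)

  -- A poor vertex of degree 4 can spare only 2 for each of its 1-paths.
  Poor : Fin n → Set
  Poor x = Thin x × Any (TwoPath x) (N G x)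

  poor? : ∀ x → Dec (Poor x)
  poor? x = thin? x ×-dec Any.any? (twoPath? x) (N G x)

  cubicEnds : Fin n → List (Fin n) → List (Fin n)
  cubicEnds w = filter (λ t → d G (opp w t) ℕ.≟ 3)

  -- A needy vertex of degree 3 must also be helped by the 3-vertices at its opposite ends.
  Needy : Fin n → Set
  Needy w = Thin w × 2 ≤ length (cubicEnds w (N G w))

  needy? : ∀ w → Dec (Needy w)
  needy? w = thin? w ×-dec (2 ≤? length (cubicEnds w (N G w)))

  thinNbrs : Fin n → List (Fin n)
  thinNbrs w = filter (λ t → d G t ℕ.≟ 2) (N G w)

  -- Arguments: degree of the recipient, degree of the donor, donor poor, recipient needy.
  giftOf : ℕ → ℕ → Bool → Bool → ℕ
  giftOf 3 4 true  _    = 2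
  giftOf 3 4 false _    = 3
  giftOf 3 3 _     true = 2
  giftOf _ _ _     _    = 0

  abstract

    -- The extra charge sent by x through a 2-vertex to the opposite end w.
    gift : Fin n → Fin n → ℕ
    gift x w = giftOf (d G w) (d G x) (does (poor? x)) (does (needy? w))

    -- Arguments: degree of the donor, degree of the recipient, number of 2-neighbours of the
    -- recipient. The amount 4 pays for two gifts of 2 that the recipient may have to send along its
    -- two thin sides.
    thickOf : ℕ → ℕ → ℕ → ℕ
    thickOf 4 3 2 = 4
    thickOf _ _ _ = 0

    -- All charge travels along edges. A gift between the ends of a 1-path first enters the 2-vertex
    -- together with the 6 meant for that vertex, which then forwards it; on a 2-path each end sends
    -- 12 to its nearest inner vertex.
    flow : Fin n → Fin n → ℕ
    flow u v = if does (d G u ℕ.≟ 2) then gift (opp v u) v else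
      if does (d G v ℕ.≟ 2) then (if does (d G (opp u v) ℕ.≟ 2) then 12 else 6 + gift u (opp u v))
      else thickOf (d G u) (d G v) (length (thinNbrs v))

    flow-from-2 : ∀ {t w x} → t ⟶ w ∷ x ∷ [] → flow t w ≡ gift x w
    flow-from-2 {t} σ rewrite dec-true (d G t ℕ.≟ 2) (⇉-degree G σ) | opp-≡ σ = refl

    flow-end : ∀ {x t w} → d G x ≢ 2 → t ⟶ x ∷ w ∷ [] → d G w ≢ 2 → flow x t ≡ 6 + gift x w
    flow-end {x} {t} {w} dx σ dw rewrite dec-false (d G x ℕ.≟ 2) dx
      | dec-true (d G t ℕ.≟ 2) (⇉-degree G σ) | opp-≡ σ | dec-false (d G w ℕ.≟ 2) dw = refl

    flow-twoPath : ∀ {x t w} → d G x ≢ 2 → t ⟶ x ∷ w ∷ [] → d G w ≡ 2 → flow x t ≡ 12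
    flow-twoPath {x} {t} {w} dx σ dw rewrite dec-false (d G x ℕ.≟ 2) dx
      | dec-true (d G t ℕ.≟ 2) (⇉-degree G σ) | opp-≡ σ | dec-true (d G w ℕ.≟ 2) dw = refl

    flow-thick : ∀ {u v} → d G u ≢ 2 → d G v ≢ 2 →
      flow u v ≡ thickOf (d G u) (d G v) (length (thinNbrs v))
    flow-thick {u} {v} du dv rewrite dec-false (d G u ℕ.≟ 2) du | dec-false (d G v ℕ.≟ 2) dv = refl

    flow-thick₃ : ∀ {u v} → d G u ≡ 3 → d G v ≢ 2 → flow u v ≡ 0
    flow-thick₃ {u} {v} du dv = trans (flow-thick (λ d2 → case trans (≡-sym du) d2 of λ ()) dv) zero′
      where
      zero′ : thickOf (d G u) (d G v) (length (thinNbrs v)) ≡ 0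
      zero′ rewrite du = refl

    flow-thick₄ : ∀ {u v} → d G u ≡ 4 → d G v ≡ 3 → length (thinNbrs v) ≡ 2 → flow u v ≡ 4
    flow-thick₄ {u} {v} du dv two = trans
      (flow-thick (λ d2 → case trans (≡-sym du) d2 of λ ()) (λ d2 → case trans (≡-sym dv) d2 of λ ())) four
      where
      four : thickOf (d G u) (d G v) (length (thinNbrs v)) ≡ 4
      four rewrite du | dv | two = refl

    flow-thick₄-cases : ∀ {u v} → d G u ≡ 4 → d G v ≡ 3 ⊎ d G v ≡ 4 →
      flow u v ≡ 0 ⊎ flow u v ≡ 4 × d G v ≡ 3 × length (thinNbrs v) ≡ 2
    flow-thick₄-cases {u} {v} du (inj₁ dv) with length (thinNbrs v) ℕ.≟ 2
    ... | yes two = inj₂ (flow-thick₄ du dv two , dv , two)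
    ... | no ¬two = inj₁ (trans
      (flow-thick (λ d2 → case trans (≡-sym du) d2 of λ ()) (λ d2 → case trans (≡-sym dv) d2 of λ ())) zero′)
      where
      thickOf-≢2 : ∀ k → k ≢ 2 → thickOf 4 3 k ≡ 0
      thickOf-≢2 0 _ = refl
      thickOf-≢2 1 _ = refl
      thickOf-≢2 2 k≢2 = ⊥-elim (k≢2 refl)
      thickOf-≢2 (suc (suc (suc _))) _ = refl
      zero′ : thickOf (d G u) (d G v) (length (thinNbrs v)) ≡ 0
      zero′ rewrite du | dv = thickOf-≢2 _ ¬two
    flow-thick₄-cases {u} {v} du (inj₂ dv) = inj₁ (trans
      (flow-thick (λ d2 → case trans (≡-sym du) d2 of λ ()) (λ d2 → case trans (≡-sym dv) d2 of λ ())) zero′)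
      where
      zero′ : thickOf (d G u) (d G v) (length (thinNbrs v)) ≡ 0
      zero′ rewrite du | dv = refl

    gift-to-2 : ∀ {x w} → d G w ≡ 2 → gift x w ≡ 0
    gift-to-2 dw rewrite dw = refl

    gift-to-4 : ∀ {x w} → d G w ≡ 4 → gift x w ≡ 0
    gift-to-4 dw rewrite dw = refl

    gift₄-≥2 : ∀ {x w} → d G x ≡ 4 → d G w ≡ 3 → 2 ≤ gift x w
    gift₄-≥2 {x} dx dw rewrite dx | dw with does (poor? x)
    ... | true  = ℕₚ.≤-refl
    ... | false = s≤s (s≤s z≤n)

    gift₄-≤3 : ∀ {x w} → d G x ≡ 4 → d G w ≡ 3 → gift x w ≤ 3
    gift₄-≤3 {x} dx dw rewrite dx | dw with does (poor? x)
    ... | true  = s≤s (s≤s z≤n)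
    ... | false = ℕₚ.≤-refl

    gift-poor : ∀ {x w} → d G x ≡ 4 → d G w ≡ 3 → Poor x → gift x w ≡ 2
    gift-poor {x} dx dw p rewrite dx | dw | dec-true (poor? x) p = refl

    gift-rich : ∀ {x w} → d G x ≡ 4 → d G w ≡ 3 → ¬ Poor x → gift x w ≡ 3
    gift-rich {x} dx dw p rewrite dx | dw | dec-false (poor? x) p = refl

    gift₃-needy : ∀ {x w} → d G x ≡ 3 → d G w ≡ 3 → Needy w → gift x w ≡ 2
    gift₃-needy {w = w} dx dw p rewrite dx | dw | dec-true (needy? w) p = refl

    gift₃-¬needy : ∀ {x w} → d G x ≡ 3 → d G w ≡ 3 → ¬ Needy w → gift x w ≡ 0
    gift₃-¬needy {w = w} dx dw p rewrite dx | dw | dec-false (needy? w) p = refl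

    gift₃-≤2 : ∀ {x w} → d G x ≡ 3 → d G w ≡ 3 → gift x w ≤ 2
    gift₃-≤2 {w = w} dx dw rewrite dx | dw with does (needy? w)
    ... | true  = ℕₚ.≤-refl
    ... | false = z≤n

  -- Nonnegativity of the final charge, `24 d − 60` minus outflow plus inflow, written without
  -- subtraction.
  record Balanced (v : Fin n) (us : List (Fin n)) : Set where
    constructor balance
    field
      inequality : 60 + sum (map (flow v) us) ≤ 24 * length us + sum (map (λ u → flow u v) us)

  balanced-↭ : ∀ {v us ws} → us ↭ ws → Balanced v us → Balanced v ws
  balanced-↭ {v} {us} {ws} σ (balance b) = balance (subst₂ _≤_
    (cong (60 +_) (sum-↭ (map⁺ (flow v) σ)))
    (cong₂ _+_ (cong (24 *_) (↭-length σ)) (sum-↭ (map⁺ (λ u → flow u v) σ))) b)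

-- Reducible configurations.

module Reducibility {n} (G : Graph n) (girth : GirthAtLeast G 10) (Δ≤4 : ∀ v → degree G v ≤ 4)
  (L : ListAssignment n) (unique : ∀ v → Unique (L v)) (six : ∀ v → 6 ≤ length (L v))
  (colour-deleted : ∀ r → 0 < degree G r → ∃ λ φ → Is2DistLColoring (delete G r) L φ) where

  private
    _⟶_ : Fin n → List (Fin n) → Set
    _⟶_ = _⇉_ G
    infix 4 _⟶_
  open Colouring G L
  open Lists unique six
  open Girth G girth using (walk-far)

  -- The induction hypothesis colours the graph without the edges at `r`; this colouring is kept
  -- outside `U`.
  uncoloured : ∀ {r a us U} s → r ∈ U → r ⟶ a ∷ us → All (λ b → b ≡ s ⊎ b ∈ U) (a ∷ us) →
    ∃ λ φ → Partial φ U
  uncoloured {r} s r∈ σ outer with colour-deleted r (subst (0 <_) (≡-sym (⇉-degree G σ)) (s≤s z≤n))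
  ... | φ , ok = φ , delete-partial s r∈ σ outer ok

  rest-≤ : ∀ {v u us k} → v ⟶ u ∷ us → d G v ≤ suc k → length us ≤ k
  rest-≤ σ le = ℕₚ.≤-pred (subst (_≤ _) (⇉-degree G σ) le)

  front-≤ : ∀ {u v k} → _~_ G v u → d G v ≤ suc k → ∃ λ us → v ⟶ u ∷ us × length us ≤ k
  front-≤ e le with ⇉-front G e
  ... | us , σ = us , σ , rest-≤ σ le

  edge : ∀ {v us u} → v ⟶ us → u ∈ us → _~_ G v u
  edge = ⇉-adj G

  back : ∀ {v us u} → v ⟶ us → u ∈ us → _~_ G u v
  back σ u∈ = ~-sym G (⇉-adj G σ u∈)

  ≢₀₁ : ∀ {v x y us} → v ⟶ x ∷ y ∷ us → x ≢ y
  ≢₀₁ σ with ⇉-unique G σ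
  ... | (x≢y ∷ _) ∷ _ = x≢y

  ≢₀₂ : ∀ {v x y z us} → v ⟶ x ∷ y ∷ z ∷ us → x ≢ z
  ≢₀₂ σ with ⇉-unique G σ
  ... | (_ ∷ x≢z ∷ _) ∷ _ = x≢z

  ≢₀₃ : ∀ {v x y z w us} → v ⟶ x ∷ y ∷ z ∷ w ∷ us → x ≢ w
  ≢₀₃ σ with ⇉-unique G σ
  ... | (_ ∷ _ ∷ x≢w ∷ _) ∷ _ = x≢w

  ≢₁₂ : ∀ {v x y z us} → v ⟶ x ∷ y ∷ z ∷ us → y ≢ z
  ≢₁₂ σ with ⇉-unique G σ
  ... | _ ∷ (y≢z ∷ _) ∷ _ = y≢z

  ≢₁₃ : ∀ {v x y z w us} → v ⟶ x ∷ y ∷ z ∷ w ∷ us → y ≢ w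
  ≢₁₃ σ with ⇉-unique G σ
  ... | _ ∷ (_ ∷ y≢w ∷ _) ∷ _ = y≢w

  ∉⇒≢ : ∀ {c : ℕ} {e cs} → c ∉ cs → e ∈ cs → c ≢ e
  ∉⇒≢ c∉ e∈ refl = c∉ e∈

  far : ∀ {a b} {c e : ℕ} → ¬ Dist≤2 G a b → Dist≤2 G a b → c ≢ e
  far ¬D D = ⊥-elim (¬D D)
  far′ : ∀ {a b} {c e : ℕ} → ¬ Dist≤2 G a b → Dist≤2 G b a → c ≢ e
  far′ ¬D D = ⊥-elim (¬D (Dist-sym D))

  -- A leaf sees its neighbour and at most three further vertices, so two of six colours remain.
  leaf-reducible : ∀ {r u} → r ⟶ u ∷ [] → Colourable
  leaf-reducible {r} {u} σ with front-≤ (back σ at0) (Δ≤4 u)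
  ... | us , ρ , le with uncoloured u at0 σ (inj₁ refl ∷ [])
  ... | φ , part = extend ((r , c) ∷ []) part (Palette.allowed P c∈ ∷ []) ([] ∷ [])
    where
    P : Palette φ (r ∷ []) r 2
    P = palette (u ∷ us) σ ((out at0 , _ , ρ , self ∷ outs there) ∷ []) (s≤s (ℕₚ.+-monoˡ-≤ 2 le))
    c = proj₁ (choose P [] (s≤s z≤n))
    c∈ = proj₁ (proj₂ (choose P [] (s≤s z≤n)))

  -- With `u` and `v` uncoloured, `v` sees at most five coloured vertices and `u`, because of the
  -- bound on `x`, at most four. So `v` is coloured first and `u` still has a choice.
  two-path-reducible : ∀ {u v x y} → u ⟶ v ∷ x ∷ [] → v ⟶ u ∷ y ∷ [] → d G x ≤ 3 → Colourable
  two-path-reducible {u} {v} {x} {y} σu σv dx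
    with front-≤ (back σu at1) dx | front-≤ (back σv at1) (Δ≤4 y)
  ... | xs , σx , lx | ys , σy , ly
    with uncoloured {U = u ∷ v ∷ []} x at0 σu (inj₂ at1 ∷ inj₁ refl ∷ [])
  ... | φ , part = extend ((u , cu) ∷ (v , cv) ∷ []) part
      (Palette.allowed Pu cu∈ ∷ Palette.allowed Pv cv∈ ∷ [])
      (((λ _ → ∉⇒≢ cu∉ at0) ∷ []) ∷ [] ∷ [])
    where
    Pu : Palette φ (u ∷ v ∷ []) u 2
    Pu = palette (x ∷ y ∷ xs) σu
      ((unc at1 , _ , σv , self ∷ out at1 ∷ []) ∷ (out at0 , _ , σx , self ∷ outs (there ∘ there)) ∷ [])
      (s≤s (s≤s (ℕₚ.+-monoˡ-≤ 2 lx)))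
    Pv : Palette φ (u ∷ v ∷ []) v 1
    Pv = palette (x ∷ y ∷ ys) σv
      ((unc at0 , _ , σu , self ∷ out at0 ∷ []) ∷ (out at1 , _ , σy , self ∷ outs (there ∘ there)) ∷ [])
      (s≤s (s≤s (ℕₚ.+-monoˡ-≤ 1 ly)))
    choice-v = choose Pv [] (s≤s z≤n)
    cv = proj₁ choice-v
    cv∈ = proj₁ (proj₂ choice-v)
    choice-u = choose Pu (cv ∷ []) (s≤s (s≤s z≤n))
    cu = proj₁ choice-u
    cu∈ = proj₁ (proj₂ choice-u)
    cu∉ = proj₂ (proj₂ choice-u)

  -- A neighbour `y` of `x` with at most four vertices within distance two on the side away from
  -- `x`; it keeps two colours when `x` and its neighbours are uncoloured.
  data Light (x y : Fin n) : Set where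
    two   : ∀ {u} → y ⟶ x ∷ u ∷ [] → Light x y
    three : ∀ {u u′ f f′} → y ⟶ x ∷ u ∷ u′ ∷ [] → u ⟶ y ∷ f ∷ [] → u′ ⟶ y ∷ f′ ∷ [] → Light x y

  light-outside : ∀ {x y} → Light x y → ∃₂ λ us cs → y ⟶ x ∷ us × length us ≤ 2 × length cs ≤ 4 ×
    (∀ U → All (Branch U cs y) us)
  light-outside {x} {y} (two {u} σ) with front-≤ (back σ at1) (Δ≤4 u)
  ... | vs , ρ , le = u ∷ [] , u ∷ vs , σ , s≤s z≤n , s≤s le ,
    λ U → (out at0 , _ , ρ , self ∷ outs there) ∷ []
  light-outside (three {u} {u′} {f} {f′} σ ρ ρ′) =
    u ∷ u′ ∷ [] , u ∷ u′ ∷ f ∷ f′ ∷ [] , σ , ℕₚ.≤-refl , ℕₚ.≤-refl ,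
    λ U → (out at0 , _ , ρ , self ∷ out at2 ∷ []) ∷ (out at1 , _ , ρ′ , self ∷ out at3 ∷ []) ∷ []

  -- Uncolouring the hub, its four neighbours and the far inner vertices of the two 2-paths leaves
  -- palettes of sizes 3 at `x` and `t`, 5 at `p` and `p′`, and 2 at `q`, `q′` and `y`. These
  -- suffice for a greedy colouring in the order `x`, `q′`, `y`, `t`, `p′`, `p`, `q`.
  hub-reducible : ∀ {x p p′ t y q q′ r r′ w} →
    x ⟶ p ∷ p′ ∷ t ∷ y ∷ [] → p ⟶ x ∷ q ∷ [] → q ⟶ p ∷ r ∷ [] →
    p′ ⟶ x ∷ q′ ∷ [] → q′ ⟶ p′ ∷ r′ ∷ [] → t ⟶ x ∷ w ∷ [] → d G w ≤ 3 → Light x y →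
    Colourable
  hub-reducible {x} {p} {p′} {t} {y} {q} {q′} {r} {r′} {w} σx σp σq σp′ σq′ σt dw light
    with front-≤ (back σq at1) (Δ≤4 r) | front-≤ (back σq′ at1) (Δ≤4 r′)
       | front-≤ (back σt at1) dw | light-outside light
  ... | rs , σr , lr | rs′ , σr′ , lr′ | ws , σw , lw | us , ys , σy , lu , ly , by
    with uncoloured {U = x ∷ p ∷ p′ ∷ q ∷ q′ ∷ t ∷ y ∷ []} x at1 σp (inj₁ refl ∷ inj₂ at3 ∷ [])
  ... | φ , part = colouring
    where
    U = x ∷ p ∷ p′ ∷ q ∷ q′ ∷ t ∷ y ∷ []
    x-seen : ∀ {cs v} → All (Seen U cs v) (p ∷ p′ ∷ t ∷ y ∷ [])
    x-seen = unc at1 ∷ unc at2 ∷ unc at5 ∷ unc at6 ∷ []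
    x-branch : ∀ {cs v} → Branch U cs v x
    x-branch = unc at0 , _ , σx , x-seen
    Px : Palette φ U x 3
    Px = palette (w ∷ us) σx
      ( (unc at1 , _ , σp , self ∷ unc at3 ∷ []) ∷ (unc at2 , _ , σp′ , self ∷ unc at4 ∷ [])
      ∷ (unc at5 , _ , σt , self ∷ out at0 ∷ []) ∷ (unc at6 , _ , σy , self ∷ outs there) ∷ [])
      (s≤s (ℕₚ.+-monoˡ-≤ 3 lu))
    Pp : Palette φ U p 5
    Pp = palette (r ∷ []) σp (x-branch ∷ (unc at3 , _ , σq , self ∷ out at0 ∷ []) ∷ []) ℕₚ.≤-refl
    Pp′ : Palette φ U p′ 5
    Pp′ = palette (r′ ∷ []) σp′ (x-branch ∷ (unc at4 , _ , σq′ , self ∷ out at0 ∷ []) ∷ []) ℕₚ.≤-refl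
    Pq : Palette φ U q 2
    Pq = palette (r ∷ rs) σq
      ((unc at1 , _ , σp , unc at0 ∷ self ∷ []) ∷ (out at0 , _ , σr , self ∷ outs there) ∷ [])
      (s≤s (ℕₚ.+-monoˡ-≤ 2 lr))
    Pq′ : Palette φ U q′ 2
    Pq′ = palette (r′ ∷ rs′) σq′
      ((unc at2 , _ , σp′ , unc at0 ∷ self ∷ []) ∷ (out at0 , _ , σr′ , self ∷ outs there) ∷ [])
      (s≤s (ℕₚ.+-monoˡ-≤ 2 lr′))
    Pt : Palette φ U t 3
    Pt = palette (w ∷ ws) σt (x-branch ∷ (out at0 , _ , σw , self ∷ outs there) ∷ [])
      (s≤s (ℕₚ.+-monoˡ-≤ 3 lw))
    Py : Palette φ U y 2
    Py = palette ys σy (x-branch ∷ by U) (ℕₚ.+-monoˡ-≤ 2 ly)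

    far₃ : ∀ {a b e} → a ⟶ x ∷ b ∷ [] → _~_ G x e → a ≢ e → ¬ Dist≤2 G b e
    far₃ σa e a≢e = walk-far _ _ _ (_ ∷ [])
      (back σa at1 , ≢-sym (≢₀₁ σa) , edge σa at0 , a≢e , e) (s≤s z≤n) at0
    far₄ : ∀ {a b e g} → a ⟶ x ∷ b ∷ [] → e ⟶ x ∷ g ∷ [] → a ≢ e → ¬ Dist≤2 G b g
    far₄ σa σe a≢e = walk-far _ _ _ (_ ∷ _ ∷ [])
      (back σa at1 , ≢-sym (≢₀₁ σa) , edge σa at0 , a≢e , back σe at0 , ≢₀₁ σe , edge σe at1)
      (s≤s (s≤s z≤n)) at1

    colouring : Colourable
    -- Three colours at `x` against two at `q`: `x` takes one outside the palette of `q`. Then `q`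
    -- only has to avoid `p` and can come last.
    colouring with choose Px (Palette.colours Pq) (s≤s (ℕₚ.≤-reflexive (Palette.size Pq)))
    ... | cx , cx∈ , cx∉ with choose Pq′ (cx ∷ []) ℕₚ.≤-refl
    ... | cq′ , cq′∈ , cq′∉ with choose Py (cx ∷ []) ℕₚ.≤-refl
    ... | cy , cy∈ , cy∉ with choose Pt (cx ∷ cy ∷ []) ℕₚ.≤-refl
    ... | ct , ct∈ , ct∉ with choose Pp′ (cx ∷ cy ∷ ct ∷ cq′ ∷ []) ℕₚ.≤-refl
    ... | cp′ , cp′∈ , cp′∉ with choose Pp (cx ∷ cy ∷ ct ∷ cp′ ∷ []) ℕₚ.≤-refl
    ... | cp , cp∈ , cp∉ with choose Pq (cp ∷ []) ℕₚ.≤-refl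
    ... | cq , cq∈ , cq∉ =
      extend ((x , cx) ∷ (p , cp) ∷ (p′ , cp′) ∷ (q , cq) ∷ (q′ , cq′) ∷ (t , ct) ∷ (y , cy) ∷ []) part
        ( Palette.allowed Px cx∈ ∷ Palette.allowed Pp cp∈ ∷ Palette.allowed Pp′ cp′∈
        ∷ Palette.allowed Pq cq∈ ∷ Palette.allowed Pq′ cq′∈ ∷ Palette.allowed Pt ct∈
        ∷ Palette.allowed Py cy∈ ∷ [])
        ( ( (λ _ → ≢-sym (∉⇒≢ cp∉ at0)) ∷ (λ _ → ≢-sym (∉⇒≢ cp′∉ at0))
          ∷ (λ _ → ≢-sym λ { refl → cx∉ cq∈ }) ∷ (λ _ → ≢-sym (∉⇒≢ cq′∉ at0))
          ∷ (λ _ → ≢-sym (∉⇒≢ ct∉ at0)) ∷ (λ _ → ≢-sym (∉⇒≢ cy∉ at0)) ∷ [])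
        ∷ ( (λ _ → ∉⇒≢ cp∉ at3) ∷ (λ _ → ≢-sym (∉⇒≢ cq∉ at0))
          ∷ far′ (far₃ σp′ (edge σx at0) (≢-sym (≢₀₁ σx)))
          ∷ (λ _ → ∉⇒≢ cp∉ at2) ∷ (λ _ → ∉⇒≢ cp∉ at1) ∷ [])
        ∷ ( far′ (far₃ σp (edge σx at1) (≢₀₁ σx))
          ∷ (λ _ → ∉⇒≢ cp′∉ at3) ∷ (λ _ → ∉⇒≢ cp′∉ at2) ∷ (λ _ → ∉⇒≢ cp′∉ at1) ∷ [])
        ∷ ( far (far₄ σp σp′ (≢₀₁ σx)) ∷ far (far₃ σp (edge σx at2) (≢₀₂ σx))
          ∷ far (far₃ σp (edge σx at3) (≢₀₃ σx)) ∷ [])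
        ∷ (far (far₃ σp′ (edge σx at2) (≢₁₂ σx)) ∷ far (far₃ σp′ (edge σx at3) (≢₁₃ σx)) ∷ [])
        ∷ ((λ _ → ∉⇒≢ ct∉ at1) ∷ []) ∷ [] ∷ [])

  extend′ : ∀ {U} cs {φ} → map proj₁ cs ≡ U → Partial φ U →
    All (λ (u , c) → Allowed φ U u c) cs → AllPairs Compatible cs → Colourable
  extend′ cs refl = extend cs

  -- Reducible configurations around a 3-vertex on three 1-paths.

  module Triple {v v₁ v₂ v₃ y y₂ y₃} (σv : v ⟶ v₁ ∷ v₂ ∷ v₃ ∷ []) (σv₁ : v₁ ⟶ v ∷ y ∷ [])
    (σv₂ : v₂ ⟶ v ∷ y₂ ∷ []) (σv₃ : v₃ ⟶ v ∷ y₃ ∷ []) (dy₂ : d G y₂ ≤ 3) where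

    ends : List (Fin n) → List (Fin n)
    ends es = v ∷ v₁ ∷ v₂ ∷ v₃ ∷ y ∷ es

    far-y₂ : ¬ Dist≤2 G v₂ y
    far-y₂ = walk-far _ _ _ (_ ∷ [])
      (edge σv₂ at0 , ≢-sym (≢₀₁ σv) , edge σv at0 , ≢₀₁ σv₁ , edge σv₁ at1) (s≤s z≤n) at0

    far-y₃ : ¬ Dist≤2 G v₃ y
    far-y₃ = walk-far _ _ _ (_ ∷ [])
      (edge σv₃ at0 , ≢-sym (≢₀₂ σv) , edge σv at0 , ≢₀₁ σv₁ , edge σv₁ at1) (s≤s z≤n) at0

    -- A coloured vertex beyond `y` that cannot conflict with `v`, `v₂` or `v₃`, and with `v₁` only
    -- through a colour recorded in `F`.
    Outlying : List ℕ → Fin n × ℕ → Set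
    Outlying F (u , c) = ¬ Dist≤2 G v u × (¬ Dist≤2 G v₁ u ⊎ c ∈ F) × ¬ Dist≤2 G v₂ u × ¬ Dist≤2 G v₃ u

    outlying : ∀ {F u c} → _~_ G y u → v₁ ≢ u → c ∈ F → Outlying F (u , c)
    outlying e v₁≢u c∈ =
        walk-far _ _ _ (_ ∷ []) w (s≤s z≤n) at0 , inj₂ c∈
      , walk-far _ _ _ (_ ∷ _ ∷ []) (edge σv₂ at0 , ≢-sym (≢₀₁ σv) , w) (s≤s (s≤s z≤n)) at1
      , walk-far _ _ _ (_ ∷ _ ∷ []) (edge σv₃ at0 , ≢-sym (≢₀₂ σv) , w) (s≤s (s≤s z≤n)) at1
      where w = edge σv at0 , ≢₀₁ σv₁ , edge σv₁ at1 , v₁≢u , e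

    outlying₂ : ∀ {F u c p} → _~_ G y p → v₁ ≢ p → p ⟶ y ∷ u ∷ [] → Outlying F (u , c)
    outlying₂ e v₁≢p σp =
        walk-far _ _ _ (_ ∷ _ ∷ []) w (s≤s (s≤s z≤n)) at1
      , inj₁ (walk-far _ _ _ (_ ∷ []) w₁ (s≤s z≤n) at0)
      , walk-far _ _ _ (_ ∷ _ ∷ _ ∷ []) (edge σv₂ at0 , ≢-sym (≢₀₁ σv) , w) (s≤s (s≤s (s≤s z≤n))) at2
      , walk-far _ _ _ (_ ∷ _ ∷ _ ∷ []) (edge σv₃ at0 , ≢-sym (≢₀₂ σv) , w) (s≤s (s≤s (s≤s z≤n))) at2
      where
      w₁ = edge σv₁ at1 , v₁≢p , e , ≢₀₁ σp , edge σp at1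
      w = edge σv at0 , ≢₀₁ σv₁ , w₁

    -- A colouring of the additional uncoloured vertices `es` once `y` has colour `c`. The bound
    -- `F-small` leaves `v₁` a colour different from those of `y`, of `v₃` and in `F`.
    record Extension (φ : Fin n → ℕ) (es : List (Fin n)) (m c : ℕ) : Set where
      field
        cs         : List (Fin n × ℕ)
        keys       : map proj₁ cs ≡ es
        allowed    : All (λ (u , a) → Allowed φ (ends es) u a) cs
        compatible : AllPairs Compatible ((y , c) ∷ cs)
        F          : List ℕ
        F-small    : 3 + length F ≤ m
        away       : All (Outlying F) cs

    -- The argument shared by the configurations below, which differ in the surroundings of `y`. The
    -- palettes have sizes 4 at `v`, 3 at `v₂` and 2 at `v₃` and `y`; the bound on the degree of
    -- `y₂` accounts for the third colour at `v₂`.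
    triple-reducible : ∀ {m} es → (∀ φ → Palette φ (ends es) y 2) →
      (∀ φ → Palette φ (ends es) v₁ m) → (∀ φ c → Extension φ es m c) → Colourable
    triple-reducible {m} es py pv₁ ext with front-≤ (back σv₂ at1) dy₂ | front-≤ (back σv₃ at1) (Δ≤4 y₃)
    ... | us₂ , σy₂ , l₂ | us₃ , σy₃ , l₃
      with uncoloured {U = ends es} v at0 σv (inj₂ at1 ∷ inj₂ at2 ∷ inj₂ at3 ∷ [])
    ... | φ , part = colouring
      where
      v-branch : ∀ {cs u} → Branch (ends es) cs u v
      v-branch = unc at0 , _ , σv , unc at1 ∷ unc at2 ∷ unc at3 ∷ []
      Py = py φ
      P₁ = pv₁ φ
      Pv : Palette φ (ends es) v 4
      Pv = palette (y₂ ∷ y₃ ∷ []) σv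
        ( (unc at1 , _ , σv₁ , self ∷ unc at4 ∷ []) ∷ (unc at2 , _ , σv₂ , self ∷ out at0 ∷ [])
        ∷ (unc at3 , _ , σv₃ , self ∷ out at1 ∷ []) ∷ []) ℕₚ.≤-refl
      P₂ : Palette φ (ends es) v₂ 3
      P₂ = palette (y₂ ∷ us₂) σv₂ (v-branch ∷ (out at0 , _ , σy₂ , self ∷ outs there) ∷ [])
        (s≤s (ℕₚ.+-monoˡ-≤ 3 l₂))
      P₃ : Palette φ (ends es) v₃ 2
      P₃ = palette (y₃ ∷ us₃) σv₃ (v-branch ∷ (out at0 , _ , σy₃ , self ∷ outs there) ∷ [])
        (s≤s (ℕₚ.+-monoˡ-≤ 2 l₃))
      open Palette using (colours)

      finish : ∀ {cv c₁ c₂ c₃ cy} (E : Extension φ es m cy) →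
        cv ∈ colours Pv → c₁ ∈ colours P₁ → c₂ ∈ colours P₂ → c₃ ∈ colours P₃ → cy ∈ colours Py →
        cv ∉ c₁ ∷ c₂ ∷ c₃ ∷ cy ∷ [] → c₁ ∉ cy ∷ c₃ ∷ Extension.F E → c₂ ∉ c₁ ∷ c₃ ∷ [] → Colourable
      finish {cv} {c₁} {c₂} {c₃} {cy} E cv∈ c₁∈ c₂∈ c₃∈ cy∈ cv∉ c₁∉ c₂∉ =
        extend′ ((v , cv) ∷ (v₁ , c₁) ∷ (v₂ , c₂) ∷ (v₃ , c₃) ∷ (y , cy) ∷ cs) (cong ends keys) part
          ( Palette.allowed Pv cv∈ ∷ Palette.allowed P₁ c₁∈ ∷ Palette.allowed P₂ c₂∈
          ∷ Palette.allowed P₃ c₃∈ ∷ Palette.allowed Py cy∈ ∷ allowed)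
          ( ( (λ _ → ∉⇒≢ cv∉ at0) ∷ (λ _ → ∉⇒≢ cv∉ at1) ∷ (λ _ → ∉⇒≢ cv∉ at2)
            ∷ (λ _ → ∉⇒≢ cv∉ at3) ∷ All.map (far ∘ proj₁) away)
          ∷ ( (λ _ → ≢-sym (∉⇒≢ c₂∉ at0)) ∷ (λ _ → ∉⇒≢ c₁∉ at1) ∷ (λ _ → ∉⇒≢ c₁∉ at0)
            ∷ All.map (λ { (_ , inj₁ ¬D , _) → far ¬D
                         ; (_ , inj₂ c∈ , _) → λ _ → ∉⇒≢ c₁∉ (there (there c∈)) }) away)
          ∷ ((λ _ → ∉⇒≢ c₂∉ at1) ∷ far far-y₂ ∷ All.map (far ∘ proj₁ ∘ proj₂ ∘ proj₂) away)
          ∷ (far far-y₃ ∷ All.map (far ∘ proj₂ ∘ proj₂ ∘ proj₂) away)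
          ∷ compatible)
        where open Extension E

      -- A colour c available at v but not at v₂ is kept off y, so that it can be used
      -- either at v or at v₁ without shrinking the palette of v₂.
      colouring : Colourable
      colouring with choose Pv (colours P₂) (s≤s (ℕₚ.≤-reflexive (Palette.size P₂)))
      ... | c , c∈ , c∉ with choose Py (c ∷ []) ℕₚ.≤-refl
      ... | cy , cy∈ , cy∉ with ext φ cy
      ... | E with choose P₃ (c ∷ []) ℕₚ.≤-refl
      ... | c₃ , c₃∈ , c₃∉ with choose P₁ (cy ∷ c₃ ∷ Extension.F E) (Extension.F-small E)
      ... | c₁ , c₁∈ , c₁∉ with c₁ ℕ.≟ c
      ... | no c₁≢c = case choose P₂ (c₁ ∷ c₃ ∷ []) ℕₚ.≤-refl of λ (c₂ , c₂∈ , c₂∉) →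
        finish E c∈ c₁∈ c₂∈ c₃∈ cy∈
          (λ { at0 → c₁≢c refl ; at1 → c∉ c₂∈ ; at2 → c₃∉ at0 ; at3 → cy∉ at0 }) c₁∉ c₂∉
      ... | yes refl with choose Pv (cy ∷ c₁ ∷ c₃ ∷ []) ℕₚ.≤-refl
      ...   | cv , cv∈ , cv∉ = case choose P₂ (cv ∷ c₃ ∷ []) ℕₚ.≤-refl of λ (c₂ , c₂∈ , c₂∉) →
        finish E cv∈ c₁∈ c₂∈ c₃∈ cy∈
          (λ { at0 → cv∉ at1 ; at1 → c₂∉ at0 ; at2 → cv∉ at2 ; at3 → cv∉ at0 }) c₁∉
          (λ { at0 → c∉ c₂∈ ; at1 → c₂∉ at1 })

    v₁-branches : ∀ {es cs} → Branch (ends es) cs v₁ v × Branch (ends es) cs y v₁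
    v₁-branches = (unc at0 , _ , σv , self ∷ unc at2 ∷ unc at3 ∷ []) , (unc at1 , _ , σv₁ , unc at0 ∷ self ∷ [])

    -- With `a` and `b` of degree 2, `y` sees only four coloured vertices and `v₁` only two, so
    -- nothing beyond `y` has to be uncoloured.
    triple-cubic-reducible : ∀ {a b a′ b′} → y ⟶ v₁ ∷ a ∷ b ∷ [] → a ⟶ y ∷ a′ ∷ [] → b ⟶ y ∷ b′ ∷ [] →
      Colourable
    triple-cubic-reducible {a} {b} {a′} {b′} σy σa σb = triple-reducible {4} []
      (λ φ → palette (a ∷ b ∷ a′ ∷ b′ ∷ []) σy
        ( proj₂ v₁-branches ∷ (out at0 , _ , σa , self ∷ out at2 ∷ [])
        ∷ (out at1 , _ , σb , self ∷ out at3 ∷ []) ∷ []) ℕₚ.≤-refl)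
      (λ φ → palette (a ∷ b ∷ []) σv₁
        (proj₁ v₁-branches ∷ (unc at4 , _ , σy , self ∷ out at0 ∷ out at1 ∷ []) ∷ []) ℕₚ.≤-refl)
      (λ φ c → record { cs = [] ; keys = refl ; allowed = [] ; compatible = [] ∷ [] ; F = []
                      ; F-small = s≤s (s≤s (s≤s z≤n)) ; away = [] })

    -- Uncolouring `a` as well secures two colours at `y`. The vertex `v₁` then has five colours,
    -- which absorbs the one colour that `a` puts into `F`.
    triple-mixed-reducible : ∀ {a b z} → y ⟶ v₁ ∷ a ∷ b ∷ [] → a ⟶ y ∷ z ∷ [] → d G b ≤ 3 → d G z ≤ 3 →
      Colourable
    triple-mixed-reducible {a} {b} {z} σy σa db dz
      with front-≤ (back σy at2) db | front-≤ (back σa at1) dz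
    ... | bs , σb , lb | zs , σz , lz = triple-reducible {5} (a ∷ [])
      (λ φ → palette (b ∷ z ∷ bs) σy
        ( proj₂ v₁-branches ∷ (unc at5 , _ , σa , self ∷ out at1 ∷ [])
        ∷ (out at0 , _ , σb , self ∷ outs (there ∘ there)) ∷ []) (s≤s (s≤s (ℕₚ.+-monoˡ-≤ 2 lb))))
      (λ φ → palette (b ∷ []) σv₁
        (proj₁ v₁-branches ∷ (unc at4 , _ , σy , self ∷ unc at5 ∷ out at0 ∷ []) ∷ []) ℕₚ.≤-refl)
      ext
      where
      Pa : ∀ φ → Palette φ (ends (a ∷ [])) a 2
      Pa φ = palette (b ∷ z ∷ zs) σa
        ( (unc at4 , _ , σy , unc at1 ∷ self ∷ out at0 ∷ [])
        ∷ (out at1 , _ , σz , self ∷ outs (there ∘ there)) ∷ []) (s≤s (s≤s (ℕₚ.+-monoˡ-≤ 2 lz)))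
      ext : ∀ φ c → Extension φ (a ∷ []) 5 c
      ext φ c with choose (Pa φ) (c ∷ []) ℕₚ.≤-refl
      ... | ca , ca∈ , ca∉ = record
        { cs = (a , ca) ∷ [] ; keys = refl ; allowed = Palette.allowed (Pa φ) ca∈ ∷ []
        ; compatible = ((λ _ → ≢-sym (∉⇒≢ ca∉ at0)) ∷ []) ∷ [] ∷ []
        ; F = ca ∷ [] ; F-small = ℕₚ.n≤1+n 4 ; away = outlying (edge σy at1) (≢₀₁ σy) at0 ∷ [] }

    -- Here the inner vertices `p` and `q` of a 2-path at `y` are uncoloured too. After `y`, first
    -- `q` and then `p` is coloured; only `p` lies close enough to `v₁` to enter `F`.
    triple-hub-reducible : ∀ {p q r s s′ f f′} → y ⟶ v₁ ∷ p ∷ s ∷ s′ ∷ [] →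
      p ⟶ y ∷ q ∷ [] → q ⟶ p ∷ r ∷ [] → s ⟶ y ∷ f ∷ [] → s′ ⟶ y ∷ f′ ∷ [] → Colourable
    triple-hub-reducible {p} {q} {r} {s} {s′} {f} {f′} σy σp σq σs σs′
      with front-≤ (back σq at1) (Δ≤4 r)
    ... | rs , σr , lr = triple-reducible {4} (p ∷ q ∷ [])
      (λ φ → palette (s ∷ s′ ∷ f ∷ f′ ∷ []) σy
        ( proj₂ v₁-branches ∷ (unc at5 , _ , σp , self ∷ unc at6 ∷ [])
        ∷ (out at0 , _ , σs , self ∷ out at2 ∷ []) ∷ (out at1 , _ , σs′ , self ∷ out at3 ∷ []) ∷ [])
        ℕₚ.≤-refl)
      (λ φ → palette (s ∷ s′ ∷ []) σv₁
        (proj₁ v₁-branches ∷ (unc at4 , _ , σy , self ∷ unc at5 ∷ out at0 ∷ out at1 ∷ []) ∷ []) ℕₚ.≤-refl)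
      ext
      where
      Pp : ∀ φ → Palette φ (ends (p ∷ q ∷ [])) p 3
      Pp φ = palette (s ∷ s′ ∷ r ∷ []) σp
        ( (unc at4 , _ , σy , unc at1 ∷ self ∷ out at0 ∷ out at1 ∷ [])
        ∷ (unc at6 , _ , σq , self ∷ out at2 ∷ []) ∷ []) ℕₚ.≤-refl
      Pq : ∀ φ → Palette φ (ends (p ∷ q ∷ [])) q 2
      Pq φ = palette (r ∷ rs) σq
        ((unc at5 , _ , σp , unc at4 ∷ self ∷ []) ∷ (out at0 , _ , σr , self ∷ outs there) ∷ [])
        (s≤s (ℕₚ.+-monoˡ-≤ 2 lr))
      ext : ∀ φ c → Extension φ (p ∷ q ∷ []) 4 c
      ext φ c with choose (Pq φ) (c ∷ []) ℕₚ.≤-refl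
      ... | cq , cq∈ , cq∉ with choose (Pp φ) (c ∷ cq ∷ []) ℕₚ.≤-refl
      ... | cp , cp∈ , cp∉ = record
        { cs = (p , cp) ∷ (q , cq) ∷ [] ; keys = refl
        ; allowed = Palette.allowed (Pp φ) cp∈ ∷ Palette.allowed (Pq φ) cq∈ ∷ []
        ; compatible = ((λ _ → ≢-sym (∉⇒≢ cp∉ at0)) ∷ (λ _ → ≢-sym (∉⇒≢ cq∉ at0)) ∷ [])
            ∷ ((λ _ → ∉⇒≢ cp∉ at1) ∷ []) ∷ [] ∷ []
        ; F = cp ∷ [] ; F-small = ℕₚ.≤-refl
        ; away = outlying (edge σy at1) (≢₀₁ σy) at0 ∷ outlying₂ (edge σy at1) (≢₀₁ σy) σp ∷ [] }

  -- Discharging in a graph without reducible configurations.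

  module Discharging (¬colourable : ¬ Colourable) where

    open Local G

    End : Fin n → Set
    End w = d G w ≡ 3 ⊎ d G w ≡ 4

    end≢2 : ∀ {w} → End w → d G w ≢ 2
    end≢2 (inj₁ d3) d2 = case trans (≡-sym d3) d2 of λ ()
    end≢2 (inj₂ d4) d2 = case trans (≡-sym d4) d2 of λ ()

    degree-cases : ∀ {u v} → _~_ G u v → d G v ≡ 2 ⊎ End v
    degree-cases {u} {v} e with front-≤ (~-sym G e) (Δ≤4 v)
    ... | []             , σ , _ = ⊥-elim (¬colourable (leaf-reducible σ))
    ... | _ ∷ []         , σ , _ = inj₁ (⇉-degree G σ)
    ... | _ ∷ _ ∷ []     , σ , _ = inj₂ (inj₁ (⇉-degree G σ))
    ... | _ ∷ _ ∷ _ ∷ [] , σ , _ = inj₂ (inj₂ (⇉-degree G σ))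
    ... | _ ∷ _ ∷ _ ∷ _ ∷ _ , _ , s≤s (s≤s (s≤s ()))

    link : ∀ {x t} → _~_ G x t → d G t ≡ 2 → ∃ λ w → t ⟶ x ∷ w ∷ []
    link {x} {t} e dt with ⇉-front G (~-sym G e)
    ... | w ∷ []    , σ = w , σ
    ... | []        , σ = case trans (≡-sym (⇉-degree G σ)) dt of λ ()
    ... | _ ∷ _ ∷ _ , σ = case trans (≡-sym (⇉-degree G σ)) dt of λ ()

    front₂ : ∀ {w t} → _~_ G w t → d G w ≡ 3 → ∃₂ λ a b → w ⟶ t ∷ a ∷ b ∷ []
    front₂ e dw with ⇉-front G e
    ... | a ∷ b ∷ []    , σ = a , b , σ
    ... | []            , σ = case trans (≡-sym (⇉-degree G σ)) dw of λ ()
    ... | _ ∷ []        , σ = case trans (≡-sym (⇉-degree G σ)) dw of λ ()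
    ... | _ ∷ _ ∷ _ ∷ _ , σ = case trans (≡-sym (⇉-degree G σ)) dw of λ ()

    flip : ∀ {t x w} → t ⟶ x ∷ w ∷ [] → t ⟶ w ∷ x ∷ []
    flip {x = x} {w} σ = ↭-trans σ (swap x w refl)

    no-two-path : ∀ {t w x} → t ⟶ x ∷ w ∷ [] → d G w ≡ 2 → ¬ d G x ≤ 3
    no-two-path σ dw dx = ¬colourable
      (two-path-reducible (flip σ) (proj₂ (link (edge σ at1) dw)) dx)

    -- Balance at 2-vertices.

    balanced₂-skew : ∀ {t u w} → t ⟶ w ∷ u ∷ [] → d G u ≡ 2 → End w → Balanced t (w ∷ u ∷ [])
    balanced₂-skew σ du (inj₁ dw) = ⊥-elim (no-two-path σ du (ℕₚ.≤-reflexive dw))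
    balanced₂-skew {t} {u} {w} σ du (inj₂ dw) = balance inequality
      where
      inequality : 60 + (flow t w + (flow t u + 0)) ≤ 48 + (flow w t + (flow u t + 0))
      inequality rewrite flow-from-2 σ | flow-from-2 (flip σ) | flow-twoPath (end≢2 (inj₂ dw)) σ du
        | gift-to-2 {w} {u} du | gift-to-4 {u} {w} dw = ℕₚ.+-monoʳ-≤ 48 (ℕₚ.m≤m+n 12 (flow u t + 0))

    -- A 2-vertex lacks 12. On a 1-path it receives 6 from either end, and the gifts from each end
    -- leave towards the other; on a 2-path the adjacent end supplies all 12.
    balanced₂ : ∀ {t u w} → t ⟶ u ∷ w ∷ [] → Balanced t (u ∷ w ∷ [])
    balanced₂ {t} {u} {w} σ with degree-cases (edge σ at0) | degree-cases (edge σ at1)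
    ... | inj₂ eu | inj₂ ew = balance inequality
      where
      eq : ∀ a b → 60 + (a + (b + 0)) ≡ 48 + (6 + b + (6 + a + 0))
      eq = solve-∀
      inequality : 60 + (flow t u + (flow t w + 0)) ≤ 48 + (flow u t + (flow w t + 0))
      inequality rewrite flow-from-2 σ | flow-from-2 (flip σ) | flow-end (end≢2 eu) σ (end≢2 ew)
        | flow-end (end≢2 ew) (flip σ) (end≢2 eu) = ℕₚ.≤-reflexive (eq (gift w u) (gift u w))
    ... | inj₁ du | inj₁ dw = ⊥-elim (no-two-path σ dw (ℕₚ.≤-trans (ℕₚ.≤-reflexive du) (ℕₚ.n≤1+n 2)))
    ... | inj₁ du | inj₂ ew = balanced-↭ (swap w u refl) (balanced₂-skew (flip σ) du ew)
    ... | inj₂ eu | inj₁ dw = balanced₂-skew σ dw eu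

    needy-intro : ∀ {w t₁ t₂ t₃ y₁ y₂ y₃} → w ⟶ t₁ ∷ t₂ ∷ t₃ ∷ [] →
      t₁ ⟶ w ∷ y₁ ∷ [] → t₂ ⟶ w ∷ y₂ ∷ [] → t₃ ⟶ w ∷ y₃ ∷ [] →
      d G y₁ ≡ 3 → d G y₂ ≡ 3 → Needy w
    needy-intro {w} {t₁} {t₂} {t₃} {y₁} {y₂} σ σ₁ σ₂ σ₃ d₁ d₂ =
      All-resp-↭ (↭-sym σ) (⇉-degree G σ₁ ∷ ⇉-degree G σ₂ ∷ ⇉-degree G σ₃ ∷ []) ,
      subst (2 ≤_) (↭-length (filter-↭ (λ t → d G (opp w t) ℕ.≟ 3) (↭-sym σ))) pair
      where
      pair : 2 ≤ length (cubicEnds w (t₁ ∷ t₂ ∷ t₃ ∷ []))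
      pair rewrite filter-accept (λ t → d G (opp w t) ℕ.≟ 3) {t₁} {t₂ ∷ t₃ ∷ []} (trans (cong (d G) (opp-≡ σ₁)) d₁)
                | filter-accept (λ t → d G (opp w t) ℕ.≟ 3) {t₂} {t₃ ∷ []} (trans (cong (d G) (opp-≡ σ₂)) d₂)
        = s≤s (s≤s z≤n)

    NeedyAt : Fin n → Fin n → Set
    NeedyAt w t = ∃₂ λ t₂ t₃ → ∃₂ λ y₂ y₃ →
      w ⟶ t ∷ t₂ ∷ t₃ ∷ [] × t₂ ⟶ w ∷ y₂ ∷ [] × t₃ ⟶ w ∷ y₃ ∷ [] × d G y₂ ≤ 3

    -- At least two of the three opposite ends are cubic, so whichever neighbour `t` is singled out,
    -- one of the other two leads to a 3-vertex. This is the shape that `Triple` asks for.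
    needy-elim : ∀ {w t} → d G w ≡ 3 → Needy w → _~_ G w t → NeedyAt w t
    needy-elim {w} {t} dw (thin , many) e with front₂ e dw
    ... | a , b , σ with All-resp-↭ σ thin
    ... | _ ∷ da ∷ db ∷ [] with link (edge σ at1) da | link (edge σ at2) db
    ... | ya , σa | yb , σb with d G ya ℕ.≟ 3 | d G yb ℕ.≟ 3
    ... | yes d₂ | _ = a , b , ya , yb , σ , σa , σb , ℕₚ.≤-reflexive d₂
    ... | no _ | yes d₂ = b , a , yb , ya , ↭-trans σ (prep t (swap a b refl)) , σb , σa , ℕₚ.≤-reflexive d₂
    ... | no ¬a | no ¬b = ⊥-elim (ℕₚ.<⇒≱ many (ℕₚ.≤-trans
        (ℕₚ.≤-reflexive (↭-length (filter-↭ P? σ)))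
        (ℕₚ.≤-trans (length-filter-∷ P? t (a ∷ b ∷ [])) (s≤s (ℕₚ.≤-reflexive (cong length none))))))
      where
      P? = λ s → d G (opp w s) ℕ.≟ 3
      none : cubicEnds w (a ∷ b ∷ []) ≡ []
      none rewrite filter-reject P? {a} {b ∷ []} (¬a ∘ trans (cong (d G) (≡-sym (opp-≡ σa))))
                 | filter-reject P? {b} {[]} (¬b ∘ trans (cong (d G) (≡-sym (opp-≡ σb)))) = refl

    exch₀₁ : ∀ {v a b us} → v ⟶ a ∷ b ∷ us → v ⟶ b ∷ a ∷ us
    exch₀₁ {a = a} {b} σ = ↭-trans σ (swap a b refl)

    exch₁₂ : ∀ {v a b c us} → v ⟶ a ∷ b ∷ c ∷ us → v ⟶ a ∷ c ∷ b ∷ us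
    exch₁₂ {a = a} {b} {c} σ = ↭-trans σ (prep a (swap b c refl))

    exch₂₃ : ∀ {v a b c e us} → v ⟶ a ∷ b ∷ c ∷ e ∷ us → v ⟶ a ∷ b ∷ e ∷ c ∷ us
    exch₂₃ {a = a} {b} {c} {e} σ = ↭-trans σ (prep a (prep b (swap c e refl)))

    3≢2 : ∀ {v} → d G v ≡ 3 → d G v ≢ 2
    3≢2 d3 = end≢2 (inj₁ d3)

    4≢2 : ∀ {v} → d G v ≡ 4 → d G v ≢ 2
    4≢2 d4 = end≢2 (inj₂ d4)

    -- Balance at 3-vertices.

    data Spoke (v t : Fin n) : Set where
      path  : ∀ {q r} → t ⟶ v ∷ q ∷ [] → q ⟶ t ∷ r ∷ [] → Spoke v t
      thin  : ∀ {w} → t ⟶ v ∷ w ∷ [] → End w → Spoke v t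
      thick : End t → Spoke v t

    spoke : ∀ {v t} → _~_ G v t → Spoke v t
    spoke e with degree-cases e
    ... | inj₂ et = thick et
    ... | inj₁ dt with link e dt
    ...   | w , σ with degree-cases (edge σ at1)
    ...     | inj₁ dw = path σ (proj₂ (link (edge σ at1) dw))
    ...     | inj₂ ew = thin σ ew

    -- A positive gift would need `wa` to be needy; then `triple-cubic-reducible` applies with `wa`
    -- as the centre and `v` in the role of `y`.
    gift₃-¬cubic : ∀ {v a b c wa wb wc} → v ⟶ a ∷ b ∷ c ∷ [] →
      a ⟶ v ∷ wa ∷ [] → b ⟶ v ∷ wb ∷ [] → c ⟶ v ∷ wc ∷ [] → End wa → gift v wa ≡ 0
    gift₃-¬cubic σ σa σb σc (inj₂ dw) = gift-to-4 dw
    gift₃-¬cubic {v} {a} {wa = wa} σ σa σb σc (inj₁ dw) with needy? wa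
    ... | no ¬needy = gift₃-¬needy (⇉-degree G σ) dw ¬needy
    ... | yes needy with needy-elim dw needy (back σa at1)
    ... | _ , _ , _ , _ , τ , τ₂ , τ₃ , le =
      ⊥-elim (¬colourable (Triple.triple-cubic-reducible τ (flip σa) τ₂ τ₃ le σ σb σc))

    -- A 2-path of a poor `x` cannot start at `b`, which leads to the 3-vertex `v`. It starts at
    -- another neighbour, and `triple-hub-reducible` applies with centre `v` and `x` in the role of
    -- `y`.
    not-poor : ∀ {v a b c x wa wc} → v ⟶ b ∷ a ∷ c ∷ [] →
      b ⟶ v ∷ x ∷ [] → a ⟶ v ∷ wa ∷ [] → c ⟶ v ∷ wc ∷ [] → d G wa ≤ 3 → d G x ≡ 4 → ¬ Poor x
    not-poor {v} {b = b} {x = x} σ σb σa σc le dx (thin-x , some) with ⇉-front G (back σb at1)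
    ... | us , ρ with All-resp-↭ ρ thin-x | Any-resp-↭ ρ some
    ... | _ ∷ _ | here (_ , d2) =
      3≢2 (⇉-degree G σ) (trans (cong (d G) (≡-sym (opp-≡ (flip σb)))) d2)
    ... | _ ∷ thin-us | there some′ with Membership.find some′
    ... | p , p∈ , dp , d2 with ∈-∃++ p∈
    ... | as , bs , refl = rest (as ++ bs) (↭-trans ρ (prep b (shift p as bs)))
          (All-resp-↭ (shift p as bs) thin-us)
      where
      rest : ∀ us → x ⟶ b ∷ p ∷ us → All (λ t → d G t ≡ 2) (p ∷ us) → ⊥
      rest (s ∷ s′ ∷ []) τ (_ ∷ ds ∷ ds′ ∷ []) with link (edge τ at1) dp
      ... | q , σp = ¬colourable (Triple.triple-hub-reducible σ σb σa σc le τ σp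
        (proj₂ (link (edge σp at1) (trans (cong (d G) (≡-sym (opp-≡ σp))) d2)))
        (proj₂ (link (edge τ at2) ds)) (proj₂ (link (edge τ at3) ds′)))
      rest []                τ _ = case trans (≡-sym (⇉-degree G τ)) dx of λ ()
      rest (_ ∷ [])          τ _ = case trans (≡-sym (⇉-degree G τ)) dx of λ ()
      rest (_ ∷ _ ∷ _ ∷ _)   τ _ = case trans (≡-sym (⇉-degree G τ)) dx of λ ()

    gift-≥2 : ∀ {v w} → d G v ≡ 3 → Needy v → End w → 2 ≤ gift w v
    gift-≥2 dv needy (inj₁ dw) = ℕₚ.≤-reflexive (≡-sym (gift₃-needy dw dv needy))
    gift-≥2 dv needy (inj₂ dw) = gift₄-≥2 dw dv

    -- If `v` is needy, each end gives at least 2. Otherwise at most one end is cubic: if there is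
    -- one, the other two ends are 4-vertices that are not poor and give 3 each; if there is none,
    -- three 4-vertices give at least 2 each.
    gifts-≥6 : ∀ {v a b c wa wb wc} → v ⟶ a ∷ b ∷ c ∷ [] →
      a ⟶ v ∷ wa ∷ [] → b ⟶ v ∷ wb ∷ [] → c ⟶ v ∷ wc ∷ [] → End wa → End wb → End wc →
      6 ≤ gift wa v + (gift wb v + gift wc v)
    gifts-≥6 {v} {wa = wa} {wb} {wc} σ σa σb σc ea eb ec with needy? v
    ... | yes needy = ℕₚ.+-mono-≤ (two′ ea) (ℕₚ.+-mono-≤ (two′ eb) (two′ ec))
      where
      two′ : ∀ {w} → End w → 2 ≤ gift w v
      two′ = gift-≥2 (⇉-degree G σ) needy
    ... | no ¬needy = go ea eb ec
      where
      dv : d G v ≡ 3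
      dv = ⇉-degree G σ
      two′ : ∀ {w} → d G w ≡ 4 → 2 ≤ gift w v
      two′ dw = gift₄-≥2 dw dv
      rich : ∀ {w} → d G w ≡ 4 → ¬ Poor w → 3 ≤ gift w v
      rich dw ¬poor = ℕₚ.≤-reflexive (≡-sym (gift-rich dw dv ¬poor))
      go : End wa → End wb → End wc → 6 ≤ gift wa v + (gift wb v + gift wc v)
      go (inj₁ da) (inj₁ db) _         = ⊥-elim (¬needy (needy-intro σ σa σb σc da db))
      go (inj₁ da) (inj₂ _)  (inj₁ dc) = ⊥-elim (¬needy (needy-intro (exch₁₂ σ) σa σc σb da dc))
      go (inj₂ _)  (inj₁ db) (inj₁ dc) = ⊥-elim (¬needy (needy-intro (exch₁₂ (exch₀₁ σ)) σb σc σa db dc))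
      go (inj₁ da) (inj₂ db) (inj₂ dc) = ℕₚ.≤-trans
        (ℕₚ.+-mono-≤
          (rich db (not-poor (exch₀₁ σ) σb σa σc (ℕₚ.≤-reflexive da) db))
          (rich dc (not-poor (exch₀₁ (exch₁₂ σ)) σc σa σb (ℕₚ.≤-reflexive da) dc)))
        (ℕₚ.m≤n+m _ (gift wa v))
      go (inj₂ da) (inj₁ db) (inj₂ dc) = ℕₚ.+-mono-≤
        (rich da (not-poor σ σa σb σc (ℕₚ.≤-reflexive db) da))
        (ℕₚ.≤-trans (rich dc (not-poor (exch₁₂ (exch₀₁ (exch₁₂ σ))) σc σb σa (ℕₚ.≤-reflexive db) dc))
          (ℕₚ.m≤n+m _ (gift wb v)))
      go (inj₂ da) (inj₂ db) (inj₁ dc) = ℕₚ.+-mono-≤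
        (rich da (not-poor (exch₁₂ σ) σa σc σb (ℕₚ.≤-reflexive dc) da))
        (ℕₚ.≤-trans (rich db (not-poor (exch₁₂ (exch₀₁ σ)) σb σc σa (ℕₚ.≤-reflexive dc) db))
          (ℕₚ.m≤m+n _ (gift wc v)))
      go (inj₂ da) (inj₂ db) (inj₂ dc) = ℕₚ.+-mono-≤ (two′ da) (ℕₚ.+-mono-≤ (two′ db) (two′ dc))

    -- The initial charge 12 falls short by 6 of the three payments of 6. The gifts received make up
    -- for this, and `v` itself sends no gifts.
    balanced₃-thin : ∀ {v a b c wa wb wc} → v ⟶ a ∷ b ∷ c ∷ [] →
      a ⟶ v ∷ wa ∷ [] → b ⟶ v ∷ wb ∷ [] → c ⟶ v ∷ wc ∷ [] → End wa → End wb → End wc →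
      Balanced v (a ∷ b ∷ c ∷ [])
    balanced₃-thin {v} {a} {b} {c} {wa} {wb} {wc} σ σa σb σc ea eb ec = balance inequality
      where
      v≢2 = 3≢2 (⇉-degree G σ)
      assoc : ∀ x y z → x + (y + z) ≡ x + (y + (z + 0))
      assoc = solve-∀
      inequality : 60 + (flow v a + (flow v b + (flow v c + 0))) ≤ 72 + (flow a v + (flow b v + (flow c v + 0)))
      inequality rewrite flow-end v≢2 σa (end≢2 ea) | flow-end v≢2 σb (end≢2 eb) | flow-end v≢2 σc (end≢2 ec)
        | gift₃-¬cubic σ σa σb σc ea | gift₃-¬cubic (exch₀₁ σ) σb σa σc eb
        | gift₃-¬cubic (exch₀₁ (exch₁₂ σ)) σc σa σb ec
        | flow-from-2 σa | flow-from-2 σb | flow-from-2 σc =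
        ℕₚ.+-monoʳ-≤ 72 (ℕₚ.≤-trans (gifts-≥6 σ σa σb σc ea eb ec)
          (ℕₚ.≤-reflexive (assoc (gift wa v) (gift wb v) (gift wc v))))

    gift₃-≤2′ : ∀ {v w} → d G v ≡ 3 → End w → gift v w ≤ 2
    gift₃-≤2′ dv (inj₁ dw) = gift₃-≤2 dv dw
    gift₃-≤2′ {v} {w} dv (inj₂ dw) = ℕₚ.≤-trans (ℕₚ.≤-reflexive (gift-to-4 {v} {w} dw)) z≤n

    two-thin : ∀ {v a b c} → v ⟶ a ∷ b ∷ c ∷ [] → d G a ≡ 2 → d G b ≡ 2 → d G c ≢ 2 →
      length (thinNbrs v) ≡ 2
    two-thin {v} {a} {b} {c} σ da db dc = trans (↭-length (filter-↭ (λ t → d G t ℕ.≟ 2) σ)) count₂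
      where
      count₂ : length (filter (λ t → d G t ℕ.≟ 2) (a ∷ b ∷ c ∷ [])) ≡ 2
      count₂ rewrite filter-accept (λ t → d G t ℕ.≟ 2) {a} {b ∷ c ∷ []} da
        | filter-accept (λ t → d G t ℕ.≟ 2) {b} {c ∷ []} db
        | filter-reject (λ t → d G t ℕ.≟ 2) {c} {[]} dc = refl

    -- If `wa` were needy, `triple-mixed-reducible` would apply with `wa` as the centre, `v` as `y`,
    -- and the 1-path through `b` as the additional one.
    gift₃-mixed : ∀ {v a b c wa wb} → v ⟶ a ∷ b ∷ c ∷ [] → a ⟶ v ∷ wa ∷ [] → b ⟶ v ∷ wb ∷ [] →
      d G c ≤ 3 → d G wa ≡ 3 → d G wb ≤ 3 → gift v wa ≡ 0
    gift₃-mixed {wa = wa} σ σa σb dc dwa dwb with needy? wa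
    ... | no ¬needy = gift₃-¬needy (⇉-degree G σ) dwa ¬needy
    ... | yes needy with needy-elim dwa needy (back σa at1)
    ... | _ , _ , _ , _ , τ , τ₂ , τ₃ , le =
      ⊥-elim (¬colourable (Triple.triple-mixed-reducible τ (flip σa) τ₂ τ₃ le σ σb dc dwb))

    -- A 4-vertex is given nothing. If exactly one end is cubic, its gift is covered by the 4-vertex
    -- at the other end. If both are cubic, either `c` is cubic and no gifts are sent, or `c` is a
    -- 4-vertex and contributes 4.
    gifts-mixed : ∀ {v a b c wa wb} → v ⟶ a ∷ b ∷ c ∷ [] → a ⟶ v ∷ wa ∷ [] → b ⟶ v ∷ wb ∷ [] →
      End wa → End wb → End c → gift v wa + gift v wb ≤ gift wa v + (gift wb v + flow c v)
    gifts-mixed {v} {c = c} {wa} {wb} σ σa σb (inj₂ da) (inj₂ db) ec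
      rewrite gift-to-4 {v} {wa} da | gift-to-4 {v} {wb} db = z≤n
    gifts-mixed {v} {c = c} {wa} {wb} σ σa σb (inj₁ da) (inj₂ db) ec
      rewrite gift-to-4 {v} {wb} db | ℕₚ.+-identityʳ (gift v wa) =
      ℕₚ.≤-trans (gift₃-≤2 (⇉-degree G σ) da) (ℕₚ.≤-trans (gift₄-≥2 db (⇉-degree G σ))
        (ℕₚ.≤-trans (ℕₚ.m≤m+n _ (flow c v)) (ℕₚ.m≤n+m _ (gift wa v))))
    gifts-mixed {v} {c = c} {wa} {wb} σ σa σb (inj₂ da) (inj₁ db) ec
      rewrite gift-to-4 {v} {wa} da =
      ℕₚ.≤-trans (gift₃-≤2 (⇉-degree G σ) db) (ℕₚ.≤-trans (gift₄-≥2 da (⇉-degree G σ)) (ℕₚ.m≤m+n _ _))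
    gifts-mixed {v} {c = c} {wa} {wb} σ σa σb (inj₁ da) (inj₁ db) (inj₁ dc)
      rewrite gift₃-mixed σ σa σb (ℕₚ.≤-reflexive dc) da (ℕₚ.≤-reflexive db)
            | gift₃-mixed (exch₀₁ σ) σb σa (ℕₚ.≤-reflexive dc) db (ℕₚ.≤-reflexive da) = z≤n
    gifts-mixed {v} {c = c} {wa} {wb} σ σa σb (inj₁ da) (inj₁ db) (inj₂ dc) =
      ℕₚ.≤-trans (ℕₚ.+-mono-≤ (gift₃-≤2 dv da) (gift₃-≤2 dv db))
        (ℕₚ.≤-trans (ℕₚ.≤-reflexive (≡-sym (flow-thick₄ dc dv
            (two-thin σ (⇉-degree G σa) (⇉-degree G σb) (4≢2 dc)))))
          (ℕₚ.≤-trans (ℕₚ.m≤n+m _ (gift wb v)) (ℕₚ.m≤n+m _ (gift wa v))))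
      where dv = ⇉-degree G σ

    balanced₃-mixed : ∀ {v a b c wa wb} → v ⟶ a ∷ b ∷ c ∷ [] → a ⟶ v ∷ wa ∷ [] → b ⟶ v ∷ wb ∷ [] →
      End wa → End wb → End c → Balanced v (a ∷ b ∷ c ∷ [])
    balanced₃-mixed {v} {a} {b} {c} {wa} {wb} σ σa σb ea eb ec = balance inequality
      where
      v≢2 = 3≢2 (⇉-degree G σ)
      lhs : ∀ x y → 60 + (6 + x + (6 + y + 0)) ≡ 72 + (x + y)
      lhs = solve-∀
      rhs : ∀ x y z → 72 + (x + (y + z)) ≡ 72 + (x + (y + (z + 0)))
      rhs = solve-∀
      inequality : 60 + (flow v a + (flow v b + (flow v c + 0))) ≤ 72 + (flow a v + (flow b v + (flow c v + 0)))
      inequality rewrite flow-end v≢2 σa (end≢2 ea) | flow-end v≢2 σb (end≢2 eb)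
        | flow-thick₃ {v} {c} (⇉-degree G σ) (end≢2 ec) | flow-from-2 σa | flow-from-2 σb =
        ℕₚ.≤-trans (ℕₚ.≤-reflexive (lhs (gift v wa) (gift v wb)))
          (ℕₚ.≤-trans (ℕₚ.+-monoʳ-≤ 72 (gifts-mixed σ σa σb ea eb ec))
            (ℕₚ.≤-reflexive (rhs (gift wa v) (gift wb v) (flow c v))))

    -- A 3-vertex sends nothing along edges to 3- and 4-vertices, so its initial charge 12 serves
    -- one neighbour alone.
    balanced₃-thick : ∀ {v a b c} → v ⟶ a ∷ b ∷ c ∷ [] → flow v a ≤ 12 → End b → End c →
      Balanced v (a ∷ b ∷ c ∷ [])
    balanced₃-thick {v} {a} {b} {c} σ le eb ec = balance inequality
      where
      inequality : 60 + (flow v a + (flow v b + (flow v c + 0))) ≤ 72 + (flow a v + (flow b v + (flow c v + 0)))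
      inequality rewrite flow-thick₃ {v} {b} (⇉-degree G σ) (end≢2 eb)
        | flow-thick₃ {v} {c} (⇉-degree G σ) (end≢2 ec) | ℕₚ.+-identityʳ (flow v a) =
        ℕₚ.≤-trans (ℕₚ.+-monoʳ-≤ 60 le) (ℕₚ.m≤m+n 72 _)

    thin₃-≤12 : ∀ {v t w} → d G v ≡ 3 → t ⟶ v ∷ w ∷ [] → End w → flow v t ≤ 12
    thin₃-≤12 {v} {w = w} dv σ ew rewrite flow-end (3≢2 dv) σ (end≢2 ew) =
      ℕₚ.+-monoʳ-≤ 6 (ℕₚ.≤-trans (gift₃-≤2′ dv ew) (s≤s (s≤s z≤n)))

    balanced₃ : ∀ {v a b c} → v ⟶ a ∷ b ∷ c ∷ [] → Balanced v (a ∷ b ∷ c ∷ [])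
    balanced₃ {v} {a} {b} {c} σ with spoke (edge σ at0) | spoke (edge σ at1) | spoke (edge σ at2)
    ... | path τ ρ | _ | _ = ⊥-elim (no-two-path τ (⇉-degree G ρ) (ℕₚ.≤-reflexive (⇉-degree G σ)))
    ... | _ | path τ ρ | _ = ⊥-elim (no-two-path τ (⇉-degree G ρ) (ℕₚ.≤-reflexive (⇉-degree G σ)))
    ... | _ | _ | path τ ρ = ⊥-elim (no-two-path τ (⇉-degree G ρ) (ℕₚ.≤-reflexive (⇉-degree G σ)))
    ... | thin σa ea | thin σb eb | thin σc ec = balanced₃-thin σ σa σb σc ea eb ec
    ... | thin σa ea | thin σb eb | thick ec   = balanced₃-mixed σ σa σb ea eb ec
    ... | thin σa ea | thick eb   | thin σc ec =
      balanced-↭ (prep a (swap c b refl)) (balanced₃-mixed (exch₁₂ σ) σa σc ea ec eb)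
    ... | thick ea   | thin σb eb | thin σc ec =
      balanced-↭ (↭-trans (prep b (swap c a refl)) (swap b a refl))
        (balanced₃-mixed (exch₁₂ (exch₀₁ σ)) σb σc eb ec ea)
    ... | thin σa ea | thick eb   | thick ec   = balanced₃-thick σ (thin₃-≤12 (⇉-degree G σ) σa ea) eb ec
    ... | thick ea   | thin σb eb | thick ec   =
      balanced-↭ (swap b a refl) (balanced₃-thick (exch₀₁ σ) (thin₃-≤12 (⇉-degree G σ) σb eb) ea ec)
    ... | thick ea   | thick eb   | thin σc ec =
      balanced-↭ (↭-trans (swap c a refl) (prep a (swap c b refl)))
        (balanced₃-thick (exch₀₁ (exch₁₂ σ)) (thin₃-≤12 (⇉-degree G σ) σc ec) ea eb)
    ... | thick ea   | thick eb   | thick ec   =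
      balanced₃-thick σ (ℕₚ.≤-trans (ℕₚ.≤-reflexive (flow-thick₃ (⇉-degree G σ) (end≢2 ea))) z≤n) eb ec

    -- Balance at 4-vertices.

    flow₄-≤4 : ∀ {x t} → d G x ≡ 4 → End t → flow x t ≤ 4
    flow₄-≤4 dx et with flow-thick₄-cases dx et
    ... | inj₁ eq       = ℕₚ.≤-trans (ℕₚ.≤-reflexive eq) z≤n
    ... | inj₂ (eq , _) = ℕₚ.≤-reflexive eq

    gift₄-≤3′ : ∀ {x w} → d G x ≡ 4 → End w → gift x w ≤ 3
    gift₄-≤3′ dx (inj₁ dw) = gift₄-≤3 dx dw
    gift₄-≤3′ {x} {w} dx (inj₂ dw) = ℕₚ.≤-trans (ℕₚ.≤-reflexive (gift-to-4 {x} {w} dw)) z≤n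

    gift-poor-≤2 : ∀ {x w} → d G x ≡ 4 → End w → Poor x → gift x w ≤ 2
    gift-poor-≤2 dx (inj₁ dw) poor = ℕₚ.≤-reflexive (gift-poor dx dw poor)
    gift-poor-≤2 {x} {w} dx (inj₂ dw) poor = ℕₚ.≤-trans (ℕₚ.≤-reflexive (gift-to-4 {x} {w} dw)) z≤n

    path⇒twoPath : ∀ {x t q r} → t ⟶ x ∷ q ∷ [] → q ⟶ t ∷ r ∷ [] → TwoPath x t
    path⇒twoPath τ ρ = ⇉-degree G τ , trans (cong (d G) (opp-≡ τ)) (⇉-degree G ρ)

    twoPath⇒path : ∀ {x t} → _~_ G x t → TwoPath x t →
      ∃₂ λ q r → t ⟶ x ∷ q ∷ [] × q ⟶ t ∷ r ∷ []
    twoPath⇒path e (dt , dq) with link e dt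
    ... | q , τ with link (edge τ at1) (trans (cong (d G) (≡-sym (opp-≡ τ))) dq)
    ... | r , ρ = q , r , τ , ρ

    flow₄-≤12 : ∀ {x t} → d G x ≡ 4 → _~_ G x t → flow x t ≤ 12
    flow₄-≤12 dx e with spoke e
    ... | path τ ρ  = ℕₚ.≤-reflexive (flow-twoPath (4≢2 dx) τ (⇉-degree G ρ))
    ... | thin τ ew = ℕₚ.≤-trans (ℕₚ.≤-reflexive (flow-end (4≢2 dx) τ (end≢2 ew)))
      (ℕₚ.+-monoʳ-≤ 6 (ℕₚ.≤-trans (gift₄-≤3′ dx ew) (ℕₚ.m≤m+n 3 3)))
    ... | thick et  = ℕₚ.≤-trans (flow₄-≤4 dx et) (ℕₚ.m≤m+n 4 8)

    flow₄-≤9 : ∀ {x t} → d G x ≡ 4 → _~_ G x t → ¬ TwoPath x t → flow x t ≤ 9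
    flow₄-≤9 dx e ¬two with spoke e
    ... | path τ ρ  = ⊥-elim (¬two (path⇒twoPath τ ρ))
    ... | thin τ ew = ℕₚ.≤-trans (ℕₚ.≤-reflexive (flow-end (4≢2 dx) τ (end≢2 ew)))
      (ℕₚ.+-monoʳ-≤ 6 (gift₄-≤3′ dx ew))
    ... | thick et  = ℕₚ.≤-trans (flow₄-≤4 dx et) (ℕₚ.m≤m+n 4 5)

    flow-poor-≤8 : ∀ {x t} → d G x ≡ 4 → _~_ G x t → ¬ TwoPath x t → Poor x → flow x t ≤ 8
    flow-poor-≤8 dx e ¬two poor with spoke e
    ... | path τ ρ  = ⊥-elim (¬two (path⇒twoPath τ ρ))
    ... | thin τ ew = ℕₚ.≤-trans (ℕₚ.≤-reflexive (flow-end (4≢2 dx) τ (end≢2 ew)))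
      (ℕₚ.+-monoʳ-≤ 6 (gift-poor-≤2 dx ew poor))
    ... | thick et  = ℕₚ.≤-trans (flow₄-≤4 dx et) (ℕₚ.m≤m+n 4 4)

    flow-thick-≤4 : ∀ {x t} → d G x ≡ 4 → _~_ G x t → d G t ≢ 2 → flow x t ≤ 4
    flow-thick-≤4 dx e dt with degree-cases e
    ... | inj₁ d2 = ⊥-elim (dt d2)
    ... | inj₂ et = flow₄-≤4 dx et

    thin-pair : ∀ {x y} → d G x ≢ 2 → _~_ G x y → d G y ≡ 3 → length (thinNbrs y) ≡ 2 → Light x y
    thin-pair {x} {y} dx e dy two-nbrs with front₂ (~-sym G e) dy
    ... | a , b , σ with filter-pair (λ t → d G t ℕ.≟ 2) dx
      (trans (≡-sym (↭-length (filter-↭ (λ t → d G t ℕ.≟ 2) σ))) two-nbrs)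
    ... | da , db = three σ (proj₂ (link (edge σ at1) da)) (proj₂ (link (edge σ at2) db))

    -- A neighbour of degree at least 3 draws charge from `x` only if it is cubic with two
    -- 2-neighbours, and such a vertex is light.
    free-or-light : ∀ {x y} → d G x ≡ 4 → _~_ G x y → flow x y ≡ 0 ⊎ Light x y
    free-or-light dx e with degree-cases e
    ... | inj₁ dy = inj₂ (two (proj₂ (link e dy)))
    ... | inj₂ ey with flow-thick₄-cases dx ey
    ...   | inj₁ eq             = inj₁ eq
    ...   | inj₂ (_ , dy , two-nbrs) = inj₂ (thin-pair (4≢2 dx) e dy two-nbrs)

    -- By `hub-reducible`, `c` leads neither into a third 2-path nor through a 1-path to a 3-vertex.
    -- What remains is a 1-path to a 4-vertex, which costs 6 without a gift, or a direct edge
    -- costing at most 4.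
    beside-light-≤6 : ∀ {x p p′ c e q r q′ r′} → x ⟶ p ∷ p′ ∷ c ∷ e ∷ [] →
      p ⟶ x ∷ q ∷ [] → q ⟶ p ∷ r ∷ [] → p′ ⟶ x ∷ q′ ∷ [] → q′ ⟶ p′ ∷ r′ ∷ [] →
      Light x e → flow x c ≤ 6
    beside-light-≤6 {x} {c = c} σ τ ρ τ′ ρ′ light with spoke (edge σ at2)
    ... | path υ κ = ⊥-elim (¬colourable (hub-reducible σ τ ρ τ′ ρ′ υ
            (ℕₚ.≤-trans (ℕₚ.≤-reflexive (⇉-degree G κ)) (ℕₚ.n≤1+n 2)) light))
    ... | thin υ (inj₁ dw) = ⊥-elim (¬colourable (hub-reducible σ τ ρ τ′ ρ′ υ (ℕₚ.≤-reflexive dw) light))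
    ... | thin {w} υ (inj₂ dw) = ℕₚ.≤-reflexive
            (trans (flow-end (4≢2 (⇉-degree G σ)) υ (4≢2 dw)) (cong (6 +_) (gift-to-4 {x} {w} dw)))
    ... | thick et = ℕₚ.≤-trans (flow₄-≤4 (⇉-degree G σ) et) (ℕₚ.m≤m+n 4 2)

    -- If one of `c`, `e` draws nothing, the other draws at most 12. Otherwise both are light, and
    -- each limits the other to 6.
    hub-≤12 : ∀ {x p p′ c e q r q′ r′} → x ⟶ p ∷ p′ ∷ c ∷ e ∷ [] →
      p ⟶ x ∷ q ∷ [] → q ⟶ p ∷ r ∷ [] → p′ ⟶ x ∷ q′ ∷ [] → q′ ⟶ p′ ∷ r′ ∷ [] →
      flow x c + flow x e ≤ 12
    hub-≤12 {x} {c = c} {e} σ τ ρ τ′ ρ′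
      with free-or-light (⇉-degree G σ) (edge σ at2) | free-or-light (⇉-degree G σ) (edge σ at3)
    ... | inj₁ eq | _ rewrite eq = flow₄-≤12 (⇉-degree G σ) (edge σ at3)
    ... | inj₂ _ | inj₁ eq rewrite eq | ℕₚ.+-identityʳ (flow x c) = flow₄-≤12 (⇉-degree G σ) (edge σ at2)
    ... | inj₂ lc | inj₂ le =
      ℕₚ.+-mono-≤ (beside-light-≤6 σ τ ρ τ′ ρ′ le) (beside-light-≤6 (exch₂₃ σ) τ ρ τ′ ρ′ lc)

    balance₄ : ∀ {x a b c e} → flow x a + (flow x b + (flow x c + flow x e)) ≤ 36 →
      Balanced x (a ∷ b ∷ c ∷ e ∷ [])
    balance₄ {x} {a} {b} {c} {e} le = balance (ℕₚ.≤-trans (ℕₚ.+-monoʳ-≤ 60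
      (subst (_≤ 36) (eq (flow x a) (flow x b) (flow x c) (flow x e)) le)) (ℕₚ.m≤m+n 96 _))
      where
      eq : ∀ p q r s → p + (q + (r + s)) ≡ p + (q + (r + (s + 0)))
      eq = solve-∀

    -- The budget is 96 - 60 = 36. Two or more 2-paths cost at most 12 + 12 + 12. One 2-path costs
    -- 12 and leaves 24: a poor vertex pays at most 8 on each other side, and otherwise some
    -- neighbour does not have degree 2, giving at most 4 + 9 + 9. Without 2-paths the cost is at
    -- most four times 9.
    balanced₄ : ∀ {x} ps qs → x ⟶ ps ++ qs → d G x ≡ 4 → All (TwoPath x) ps → All (¬_ ∘ TwoPath x) qs →
      Balanced x (ps ++ qs)
    balanced₄ {x} (p ∷ p′ ∷ ps) qs σ dx (pp ∷ pp′ ∷ _) _ = go (ps ++ qs) σ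
      where
      go : ∀ us → x ⟶ p ∷ p′ ∷ us → Balanced x (p ∷ p′ ∷ us)
      go (c ∷ e ∷ []) σ = balance₄ (ℕₚ.+-mono-≤ (flow₄-≤12 dx (edge σ at0))
        (ℕₚ.+-mono-≤ (flow₄-≤12 dx (edge σ at1)) (hub-≤12 σ τ ρ τ′ ρ′)))
        where
        path-p  = twoPath⇒path (edge σ at0) pp
        path-p′ = twoPath⇒path (edge σ at1) pp′
        τ  = proj₁ (proj₂ (proj₂ path-p))
        ρ  = proj₂ (proj₂ (proj₂ path-p))
        τ′ = proj₁ (proj₂ (proj₂ path-p′))
        ρ′ = proj₂ (proj₂ (proj₂ path-p′))
      go []                σ = case trans (≡-sym (⇉-degree G σ)) dx of λ ()
      go (_ ∷ [])          σ = case trans (≡-sym (⇉-degree G σ)) dx of λ ()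
      go (_ ∷ _ ∷ _ ∷ _)   σ = case trans (≡-sym (⇉-degree G σ)) dx of λ ()
    balanced₄ {x} (p ∷ []) (a ∷ b ∷ c ∷ []) σ dx (pp ∷ []) (¬a ∷ ¬b ∷ ¬c ∷ []) =
      balance₄ (ℕₚ.+-mono-≤ (flow₄-≤12 dx (edge σ at0)) (others (poor? x)))
      where
      ≤9 : ∀ {t} → t ∈ p ∷ a ∷ b ∷ c ∷ [] → ¬ TwoPath x t → flow x t ≤ 9
      ≤9 t∈ = flow₄-≤9 dx (edge σ t∈)
      others : Dec (Poor x) → flow x a + (flow x b + flow x c) ≤ 24
      others (yes poor) = ℕₚ.+-mono-≤ (≤8 at1 ¬a) (ℕₚ.+-mono-≤ (≤8 at2 ¬b) (≤8 at3 ¬c))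
        where
        ≤8 : ∀ {t} → t ∈ p ∷ a ∷ b ∷ c ∷ [] → ¬ TwoPath x t → flow x t ≤ 8
        ≤8 t∈ ¬t = flow-poor-≤8 dx (edge σ t∈) ¬t poor
      others (no ¬poor) with d G a ℕ.≟ 2 | d G b ℕ.≟ 2 | d G c ℕ.≟ 2
      ... | yes da | yes db | yes dc = ⊥-elim (¬poor
        ( All-resp-↭ (↭-sym σ) (proj₁ pp ∷ da ∷ db ∷ dc ∷ [])
        , Any-resp-↭ (↭-sym σ) (here pp)))
      ... | no da | _ | _ = ℕₚ.≤-trans (ℕₚ.+-mono-≤ (flow-thick-≤4 dx (edge σ at1) da)
        (ℕₚ.+-mono-≤ (≤9 at2 ¬b) (≤9 at3 ¬c))) (ℕₚ.m≤m+n 22 2)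
      ... | yes _ | no db | _ = ℕₚ.≤-trans (ℕₚ.+-mono-≤ (≤9 at1 ¬a)
        (ℕₚ.+-mono-≤ (flow-thick-≤4 dx (edge σ at2) db) (≤9 at3 ¬c))) (ℕₚ.m≤m+n 22 2)
      ... | yes _ | yes _ | no dc = ℕₚ.≤-trans (ℕₚ.+-mono-≤ (≤9 at1 ¬a)
        (ℕₚ.+-mono-≤ (≤9 at2 ¬b) (flow-thick-≤4 dx (edge σ at3) dc))) (ℕₚ.m≤m+n 22 2)
    balanced₄ {x} [] (a ∷ b ∷ c ∷ e ∷ []) σ dx _ (¬a ∷ ¬b ∷ ¬c ∷ ¬e ∷ []) =
      balance₄ (ℕₚ.+-mono-≤ (≤9 at0 ¬a) (ℕₚ.+-mono-≤ (≤9 at1 ¬b) (ℕₚ.+-mono-≤ (≤9 at2 ¬c) (≤9 at3 ¬e))))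
      where
      ≤9 : ∀ {t} → t ∈ a ∷ b ∷ c ∷ e ∷ [] → ¬ TwoPath x t → flow x t ≤ 9
      ≤9 t∈ = flow₄-≤9 dx (edge σ t∈)
    balanced₄ (_ ∷ []) []                        σ dx = case trans (≡-sym (⇉-degree G σ)) dx of λ ()
    balanced₄ (_ ∷ []) (_ ∷ [])                  σ dx = case trans (≡-sym (⇉-degree G σ)) dx of λ ()
    balanced₄ (_ ∷ []) (_ ∷ _ ∷ [])              σ dx = case trans (≡-sym (⇉-degree G σ)) dx of λ ()
    balanced₄ (_ ∷ []) (_ ∷ _ ∷ _ ∷ _ ∷ _)       σ dx = case trans (≡-sym (⇉-degree G σ)) dx of λ ()
    balanced₄ []       []                        σ dx = case trans (≡-sym (⇉-degree G σ)) dx of λ ()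
    balanced₄ []       (_ ∷ [])                  σ dx = case trans (≡-sym (⇉-degree G σ)) dx of λ ()
    balanced₄ []       (_ ∷ _ ∷ [])              σ dx = case trans (≡-sym (⇉-degree G σ)) dx of λ ()
    balanced₄ []       (_ ∷ _ ∷ _ ∷ [])          σ dx = case trans (≡-sym (⇉-degree G σ)) dx of λ ()
    balanced₄ []       (_ ∷ _ ∷ _ ∷ _ ∷ _ ∷ _)   σ dx = case trans (≡-sym (⇉-degree G σ)) dx of λ ()

    balanced : ∀ v → N G v ≡ [] ⊎ Balanced v (N G v)
    balanced v = go (N G v) refl (Δ≤4 v)
      where
      go : ∀ us → v ⟶ us → length us ≤ 4 → us ≡ [] ⊎ Balanced v us
      go []               _ _ = inj₁ refl
      go (a ∷ [])         σ _ = ⊥-elim (¬colourable (leaf-reducible σ))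
      go (a ∷ b ∷ [])     σ _ = inj₂ (balanced₂ σ)
      go (a ∷ b ∷ c ∷ []) σ _ = inj₂ (balanced₃ σ)
      go us@(_ ∷ _ ∷ _ ∷ _ ∷ []) σ _ = inj₂ (balanced-↭ (↭-sym split)
        (balanced₄ (filter P? us) (filter (¬? ∘ P?) us) (↭-trans σ split) (⇉-degree G σ)
          (Allₚ.all-filter P? us) (Allₚ.all-filter (¬? ∘ P?) us)))
        where
        P? = twoPath? v
        split = split-↭ P? us
      go (_ ∷ _ ∷ _ ∷ _ ∷ _ ∷ _) _ (s≤s (s≤s (s≤s (s≤s ()))))

-- Finite sums and double counting.

ind : Bool → ℕ
ind b = if b then 1 else 0

ind-∧ : ∀ a b → ind (a ∧ b) ≤ ind a
ind-∧ false _     = z≤n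
ind-∧ true  false = z≤n
ind-∧ true  true  = ℕₚ.≤-refl

module _ {A : Set} where

  sum-mono : ∀ {f g : A → ℕ} xs → (∀ x → f x ≤ g x) → sum (map f xs) ≤ sum (map g xs)
  sum-mono []       le = z≤n
  sum-mono (x ∷ xs) le = ℕₚ.+-mono-≤ (le x) (sum-mono xs le)

  sum-strict : ∀ {f g : A → ℕ} {xs z} → (∀ x → f x ≤ g x) → z ∈ xs → f z < g z →
    sum (map f xs) < sum (map g xs)
  sum-strict {xs = x ∷ xs} le (here refl) lt = ℕₚ.+-mono-<-≤ lt (sum-mono xs le)
  sum-strict {xs = x ∷ xs} le (there z∈)  lt = ℕₚ.+-mono-≤-< (le x) (sum-strict le z∈ lt)

  sum-+ : ∀ (f g : A → ℕ) xs → sum (map (λ x → f x + g x) xs) ≡ sum (map f xs) + sum (map g xs)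
  sum-+ f g []       = refl
  sum-+ f g (x ∷ xs) rewrite sum-+ f g xs = eq (f x) (g x) (sum (map f xs)) (sum (map g xs))
    where
    eq : ∀ a b c e → a + b + (c + e) ≡ a + c + (b + e)
    eq = solve-∀

  sum-* : ∀ k (f : A → ℕ) xs → sum (map (λ x → k * f x) xs) ≡ k * sum (map f xs)
  sum-* k f []       = ≡-sym (ℕₚ.*-zeroʳ k)
  sum-* k f (x ∷ xs) rewrite sum-* k f xs = ≡-sym (ℕₚ.*-distribˡ-+ k (f x) _)

  sum-cong : ∀ {f g : A → ℕ} xs → (∀ x → f x ≡ g x) → sum (map f xs) ≡ sum (map g xs)
  sum-cong []       eq = refl
  sum-cong (x ∷ xs) eq = cong₂ _+_ (eq x) (sum-cong xs eq)

  sum-0 : ∀ (xs : List A) → sum (map (λ _ → 0) xs) ≡ 0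
  sum-0 []       = refl
  sum-0 (_ ∷ xs) = sum-0 xs

  sum-filter : ∀ (b : A → Bool) (f : A → ℕ) xs →
    sum (map f (filter (T? ∘ b) xs)) ≡ sum (map (λ x → ind (b x) * f x) xs)
  sum-filter b f []       = refl
  sum-filter b f (x ∷ xs) with b x
  ... | true  = cong₂ _+_ (≡-sym (ℕₚ.*-identityˡ (f x))) (sum-filter b f xs)
  ... | false = sum-filter b f xs

  length-filter-sum : ∀ (b : A → Bool) xs → length (filter (T? ∘ b) xs) ≡ sum (map (ind ∘ b) xs)
  length-filter-sum b []       = refl
  length-filter-sum b (x ∷ xs) with b x
  ... | true  = cong suc (length-filter-sum b xs)
  ... | false = length-filter-sum b xs

sum-swap : ∀ {A B : Set} (f : A → B → ℕ) xs ys →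
  sum (map (λ x → sum (map (f x) ys)) xs) ≡ sum (map (λ y → sum (map (λ x → f x y) xs)) ys)
sum-swap f []       ys = ≡-sym (sum-0 ys)
sum-swap f (x ∷ xs) ys = trans (cong (sum (map (f x) ys) +_) (sum-swap f xs ys))
  (≡-sym (sum-+ (f x) (λ y → sum (map (λ z → f z y) xs)) ys))

sum-concatMap : ∀ {A B : Set} (f : B → ℕ) (g : A → List B) xs →
  sum (map f (concatMap g xs)) ≡ sum (map (λ x → sum (map f (g x))) xs)
sum-concatMap f g []       = refl
sum-concatMap f g (x ∷ xs) = trans (cong sum (map-++ f (g x) (concatMap g xs)))
  (trans (sum-++ (map f (g x)) _) (cong (sum (map f (g x)) +_) (sum-concatMap f g xs)))

length-filter-pairs : ∀ {A B : Set} (q : A × B → Bool) xs ys →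
  length (filter (λ p → T? (q p)) (concatMap (λ x → map (λ y → (x , y)) ys) xs)) ≡
  sum (map (λ x → sum (map (λ y → ind (q (x , y))) ys)) xs)
length-filter-pairs q xs ys = trans (length-filter-sum q (concatMap (λ x → map (λ y → (x , y)) ys) xs))
  (trans (sum-concatMap (ind ∘ q) (λ x → map (λ y → (x , y)) ys) xs)
    (sum-cong xs (λ x → cong sum (≡-sym (map-∘ {g = ind ∘ q} {f = λ y → (x , y)} ys)))))

∣tabulate∣ : ∀ {n} (b : Fin n → Bool) → ∣ Vec.tabulate b ∣ ≡ sum (map (ind ∘ b) (allFin n))
∣tabulate∣ b = trans (go b) (cong sum (≡-sym (map-tabulate id (ind ∘ b))))
  where
  go : ∀ {n} (b : Fin n → Bool) → ∣ Vec.tabulate b ∣ ≡ sum (tabulate (ind ∘ b))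
  go {zero}  b = refl
  go {suc n} b with b zero
  ... | true  = cong suc (go (b ∘ suc))
  ... | false = go (b ∘ suc)

-- Degree sums.

module _ {n} (G : Graph n) where

  degreeSum : ℕ
  degreeSum = sum (map (d G) (allFin n))

  d-sum : ∀ v → d G v ≡ sum (map (ind ∘ adj G v) (allFin n))
  d-sum v = length-filter-sum (adj G v) (allFin n)

  -- The handshake bound: each ordered adjacent pair is counted by `up` in one of its two orders,
  -- and both double sums of `up` equal the number of edges.
  degreeSum-≤ : degreeSum ≤ 2 * edgeCount (adj G)
  degreeSum-≤ = begin
    degreeSum                                            ≡⟨ sum-cong V d-sum ⟩
    ΣΣ (λ v u → ind (adj G v u))                         ≤⟨ sum-mono V (λ v → sum-mono V (λ u → oriented v u)) ⟩
    ΣΣ (λ v u → up v u + up u v)                         ≡⟨ sum-cong V (λ v → sum-+ (up v) (λ u → up u v) V) ⟩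
    sum (map (λ v → row up v + row (λ v u → up u v) v) V) ≡⟨ sum-+ (row up) (row (λ v u → up u v)) V ⟩
    ΣΣ up + ΣΣ (λ v u → up u v)                          ≡⟨ cong (ΣΣ up +_) (≡-sym (sum-swap up V V)) ⟩
    ΣΣ up + ΣΣ up                                        ≡⟨ cong₂ _+_ (≡-sym count-edges) (≡-sym count-edges) ⟩
    E + E                                                ≡⟨ cong (E +_) (≡-sym (ℕₚ.+-identityʳ E)) ⟩
    2 * E                                                ∎
    where
    open ℕₚ.≤-Reasoning
    V = allFin n
    E = edgeCount (adj G)
    row : (Fin n → Fin n → ℕ) → Fin n → ℕ
    row f v = sum (map (f v) V)
    ΣΣ : (Fin n → Fin n → ℕ) → ℕ
    ΣΣ f = sum (map (row f) V)
    up : Fin n → Fin n → ℕ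
    up u v = ind (does (u <ᶠ? v) ∧ adj G u v)
    count-edges : E ≡ ΣΣ up
    count-edges = length-filter-pairs _ V V
    oriented : ∀ v u → ind (adj G v u) ≤ up v u + up u v
    oriented v u with <-cmp v u
    ... | tri< v<u _ _ rewrite dec-true (v <ᶠ? u) v<u = ℕₚ.m≤m+n _ _
    ... | tri> _ _ u<v rewrite dec-true (u <ᶠ? v) u<v | Graph.sym G u v = ℕₚ.m≤n+m _ _
    ... | tri≈ _ refl _ rewrite irrefl G v = z≤n

-- Hypotheses inherited under deletion.

delete-girth : ∀ {n} {G : Graph n} {g} r → GirthAtLeast G g → GirthAtLeast (delete G r) g
delete-girth {G = G} r girth m f lt (2≤m , inj , steps , close) =
  girth m f lt (2≤m , inj , (λ i → delete-~⁻ {G = G} (steps i)) , delete-~⁻ {G = G} close)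

delete-mad : ∀ {n} {G : Graph n} {p q} r → MadLess G p q → MadLess (delete G r) p q
delete-mad {G = G} r mad H = mad (record
  { verts = verts H ; edges = edges H ; edgesSym = edgesSym H
  ; edgesSub = λ u v e → delete-~⁻ {G = G} (edgesSub H u v e) ; edgesIn = edgesIn H })

delete-d : ∀ {n} (G : Graph n) r v → d (delete G r) v ≤ d G v
delete-d {n} G r v rewrite d-sum (delete G r) v | d-sum G v =
  sum-mono (allFin n) (λ u → ind-∧ (adj G v u) _)

delete-d-self : ∀ {n} (G : Graph n) r → d (delete G r) r ≡ 0
delete-d-self G r with N (delete G r) r in eq
... | []    = refl
... | u ∷ _ = ⊥-elim (delete-isolated {G = G} {v = u} (⇉-adj (delete G r) (↭-reflexive eq) at0))

-- No degree grows, and that of `r` drops from a positive value to 0. This is the measure for the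
-- induction.
delete-degreeSum : ∀ {n} (G : Graph n) r → 0 < d G r → degreeSum (delete G r) < degreeSum G
delete-degreeSum G r pos = sum-strict (delete-d G r) (∈-allFin r)
  (subst (_< d G r) (≡-sym (delete-d-self G r)) pos)

-- The charge count contradicts the bound on the maximum average degree.

module _ {n} (G : Graph n) (mad : MadLess G 5 2) (girth : GirthAtLeast G 10)
  (Δ≤4 : ∀ v → degree G v ≤ 4)
  (L : ListAssignment n) (unique : ∀ v → Unique (L v)) (six : ∀ v → 6 ≤ length (L v))
  (colour-deleted : ∀ r → 0 < degree G r → ∃ λ φ → Is2DistLColoring (delete G r) L φ) where

  open Colouring G L
  open Local G using (flow; Balanced; balance)

  private
    V = allFin n

  active : Fin n → Bool
  active v = 0 ℕ.<ᵇ d G v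

  -- Deletion leaves isolated vertices behind, whose initial charge would be -60; the density bound
  -- is therefore applied to the non-isolated vertices only.
  support : Subgraph G
  support = record
    { verts = Vec.tabulate active ; edges = adj G ; edgesSym = Graph.sym G ; edgesSub = λ _ _ e → e
    ; edgesIn = λ u v e → member e , member (~-sym G e) }
    where
    member : ∀ {u v} → _~_ G u v → Vec.tabulate active Vec.[ u ]= true
    member {u} e with ⇉-front G e
    ... | us , σ = Vecₚ.lookup⇒[]= u _ (trans (Vecₚ.lookup∘tabulate active u)
      (cong (0 ℕ.<ᵇ_) (⇉-degree G σ)))

  -- The indicator cancels the 60 at isolated vertices, so the inequality can be summed over all of
  -- `Fin n`.
  charge : ∀ v us → us ≡ [] ⊎ Balanced v us →
    60 * ind (0 ℕ.<ᵇ length us) + sum (map (flow v) us) ≤ 24 * length us + sum (map (λ u → flow u v) us)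
  charge v []       _                  = z≤n
  charge v (_ ∷ _)  (inj₂ (balance le)) = le

  colourable : Colourable
  colourable = decidable-stable colourable? contradiction
    where
    contradiction : ¬ ¬ Colourable
    contradiction ¬col with any? (λ v → 0 ℕ.<? d G v)
    ... | no isolated = ¬col ((λ v → proj₁ (pick [] (unique v) (ℕₚ.≤-trans (s≤s z≤n) (six v)))) ,
        (λ v → proj₁ (proj₂ (pick [] (unique v) (ℕₚ.≤-trans (s≤s z≤n) (six v))))) ,
        λ { u v _ (inj₁ e) → no-edge e ; u v _ (inj₂ (_ , e , _)) → no-edge e })
      where
      no-edge : ∀ {u v} {X : Set} → _~_ G u v → X
      no-edge {u} e = ⊥-elim (isolated (u , subst (0 <_) (≡-sym (⇉-degree G (proj₂ (⇉-front G e)))) (s≤s z≤n)))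
    ... | yes (v , pos) = ℕₚ.<⇒≱ sparse dense
      where
      open Reducibility G girth Δ≤4 L unique six colour-deleted using (module Discharging)
      open Discharging ¬col using (balanced)
      E = edgeCount (adj G)
      S = sum (map (ind ∘ active) V)
      sparse : 2 * (2 * E) < 5 * S
      sparse = subst (λ k → 2 * (2 * E) < 5 * k) (∣tabulate∣ active)
        (mad support (v , Vecₚ.lookup⇒[]= v _ (trans (Vecₚ.lookup∘tabulate active v) (active-v pos))))
        where
        active-v : ∀ {k} → 0 < k → (0 ℕ.<ᵇ k) ≡ true
        active-v (s≤s _) = refl
      outflow inflow : Fin n → ℕ
      outflow v = sum (map (λ u → ind (adj G v u) * flow v u) V)
      inflow v  = sum (map (λ u → ind (adj G v u) * flow u v) V)
      local : ∀ v → 60 * ind (active v) + outflow v ≤ 24 * d G v + inflow v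
      local v = subst₂ (λ a b → 60 * ind (active v) + a ≤ 24 * d G v + b)
        (sum-filter (adj G v) (flow v) V) (sum-filter (adj G v) (λ u → flow u v) V)
        (charge v (N G v) (balanced v))
      -- What leaves along an edge arrives at its other end: exchanging the two sums and using
      -- symmetry of adjacency turns inflow into outflow.
      conserved : sum (map inflow V) ≡ sum (map outflow V)
      conserved = trans (sum-swap (λ v u → ind (adj G v u) * flow u v) V V)
        (sum-cong V λ u → sum-cong V λ v → cong (λ b → ind b * flow u v) (Graph.sym G v u))
      total : 60 * S + sum (map outflow V) ≤ 24 * degreeSum G + sum (map outflow V)
      total = subst₂ _≤_
        (trans (sum-+ (λ v → 60 * ind (active v)) outflow V) (cong (_+ sum (map outflow V)) (sum-* 60 (ind ∘ active) V)))
        (trans (sum-+ (λ v → 24 * d G v) inflow V) (cong₂ _+_ (sum-* 24 (d G) V) conserved))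
        (sum-mono V local)
      dense : 5 * S ≤ 2 * (2 * E)
      -- The common factor 12 of 60 and 24 turns the charge inequality into average degree at least
      -- 5/2.
      dense = ℕₚ.*-cancelˡ-≤ 12 (begin
        12 * (5 * S)        ≡⟨ ≡-sym (ℕₚ.*-assoc 12 5 S) ⟩
        60 * S              ≤⟨ ℕₚ.+-cancelʳ-≤ _ _ _ total ⟩
        24 * degreeSum G    ≤⟨ ℕₚ.*-monoʳ-≤ 24 (degreeSum-≤ G) ⟩
        24 * (2 * E)        ≡⟨ ℕₚ.*-assoc 12 2 (2 * E) ⟩
        12 * (2 * (2 * E))  ∎)
        where open ℕₚ.≤-Reasoning

-- Induction on a bound for the degree sum, since deletion keeps the number of vertices. The degree
-- condition is an upper bound because deletion preserves that, while it may lower the maximum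
-- degree.
colourable-< : ∀ k {n} (G : Graph n) → degreeSum G < k → MadLess G 5 2 → GirthAtLeast G 10 →
  (∀ v → degree G v ≤ 4) → ListChi2AtMost G 6
colourable-< (suc k) G (s≤s le) mad girth Δ≤4 L unique six =
  colourable G mad girth Δ≤4 L unique six λ r pos →
    colourable-< k (delete G r) (ℕₚ.<-≤-trans (delete-degreeSum G r pos) le)
      (delete-mad {G = G} {5} {2} r mad) (delete-girth {G = G} r girth)
      (λ v → ℕₚ.≤-trans (delete-d G r v) (Δ≤4 v)) L unique six

theorem7 : ∀ {n : ℕ} (G : Graph n) →
    MadLess G 5 2 → GirthAtLeast G 10 → MaxDegreeEq G 4 →
    ListChi2AtMost G 6
theorem7 G mad girth (Δ≤4 , _) = colourable-< (suc (degreeSum G)) G ℕₚ.≤-refl mad girth Δ≤4
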